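{- Let $n\ge 2$, $m\geq 1$ and $k\geq 0$ be integers with $km \leq n-1$. The number of prime parking functions of length $n$ with exactly $k$ $m$-cycles is $$\sum_{\substack{\ell\ge 0\\ (k+\ell)m \leq n-1}} (-1)^{\ell}\, \frac{\left((m-1)!\right)^{k+\ell}}{k!\,\ell!} \binom{n-1}{m, \dots, m,\, n-(k+\ell)m-1} (n-1)^{n-(k+\ell)m-1},$$ where in the multinomial coefficient the entry $m$ is repeated $k+\ell$ times.
   Context: A parking function of length $n$ is a sequence $\pi=(\pi_1,\dots,\pi_n)$ of positive integers such that, if $\lambda_1\le\cdots\le\lambda_n$ is the weakly increasing rearrangement of $\pi_1,\dots,\pi_n$, then $\lambda_i\le i$ for all $1\le i\le n$. A parking function $\pi$ of length $n$ is prime if for all $1\le j\le n-1$ one has $\#\{i: \pi_i\le j\}\ge j+1$. For $m\ge 1$, distinct indices $(i_1,\dots,i_m)$ in $\{1,\dots,n\}$ form an $m$-cycle of $\pi$ if $\pi_{i_1}=i_2,\ \pi_{i_2}=i_3,\dots,\pi_{i_{m-1}}=i_m,\ \pi_{i_m}=i_1$; tuples that differ by a cyclic rotation are regarded as the same $m$-cycle. For $m=1$ an $m$-cycle is a fixed point, i.e. an index $i$ with $\pi_i=i$. The multinomial coefficient with $k+\ell$ entries equal to $m$ is $\binom{n-1}{m,\dots,m,\,n-(k+\ell)m-1}=\frac{(n-1)!}{(m!)^{k+\ell}\,(n-(k+\ell)m-1)!}$. -}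

module Defs where

open import Data.Fin using (Fin; toℕ)
open import Data.Fin.Properties using (toℕ-fromℕ<; toℕ-injective; toℕ<n)
import Data.Integer as ℤ
open import Data.List using (List; length; map; foldr; filter; upTo; replicate; _∷ʳ_)
import Data.List.Membership.Setoid as Membership
open import Data.List.Relation.Binary.Permutation.Propositional using (_↭_)
open import Data.List.Relation.Unary.All using (All; universal)
open import Data.List.Relation.Unary.All.Properties using (map⁺)
open import Data.List.Relation.Unary.Sorted.TotalOrder using (Sorted)
import Data.List.Relation.Unary.Unique.Setoid as UniqueSetoid
open import Data.Nat.Base
  using (ℕ; suc; pred; _+_; _*_; _∸_; _^_; _!; _%_; _≤_; NonZero)
open import Data.Nat.DivMod
  using (_mod_; m%n<n; m<n⇒m%n≡m; %-distribˡ-+; m%n%n≡m%n; [m+kn]%n≡m%n)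
open import Data.Nat.ListAction using (product)
open import Data.Nat.ListAction.Properties using (product≢0)
open import Data.Nat.Properties
  using (≤-totalOrder; _≤?_; +-assoc; +-comm; *-comm; _!≢0; m*n≢0)
open import Data.Product using (∃-syntax; _,_)
open import Data.Rational as ℚ using (ℚ; 0ℚ)
open import Data.Vec using (Vec; lookup; toList; count)
import Data.Vec.Relation.Unary.All as VecAll
open import Data.Vec.Relation.Unary.Unique.Propositional using (Unique)
open import Level using (Level; 0ℓ; _⊔_)
open import Relation.Binary using (Setoid; IsEquivalence)
open import Relation.Binary.PropositionalEquality using (_≡_; cong; sym; module ≡-Reasoning)
open ≡-Reasoning

-- There are exactly N elements satisfying P, counted up to the equality of S.
record HasCardinality {a ℓ p : Level} (S : Setoid a ℓ)
                      (P : Setoid.Carrier S → Set p) (N : ℕ) : Set (a ⊔ ℓ ⊔ p) where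
  open Setoid S using (Carrier)
  open Membership S using (_∈_)
  field
    elements : List Carrier
    sound    : All P elements
    complete : ∀ x → P x → x ∈ elements
    distinct : UniqueSetoid.Unique S elements
    size     : length elements ≡ N

-- Sequences are indexed by Fin n: the entry π_i of the sequence π₁, …, πₙ is
-- lookup π j with i = suc (toℕ j).

record IsParkingFunction {n : ℕ} (π : Vec ℕ n) : Set where
  field
    positive      : VecAll.All (1 ≤_) π
    rearrangement : Vec ℕ n
    permuted      : toList rearrangement ↭ toList π
    increasing    : Sorted ≤-totalOrder (toList rearrangement)
    bounded       : ∀ i → lookup rearrangement i ≤ suc (toℕ i)

record IsPrimeParkingFunction {n : ℕ} (π : Vec ℕ n) : Set where
  field
    isParkingFunction : IsParkingFunction π
    prime             : ∀ j → 1 ≤ j → j ≤ n ∸ 1 → j + 1 ≤ count (_≤? j) π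

module _ {m : ℕ} .{{_ : NonZero m}} where

  shift : ℕ → Fin m → Fin m
  shift r j = (toℕ j + r) mod m

  record IsCycle {n : ℕ} (π : Vec ℕ n) (c : Vec (Fin n) m) : Set where
    field
      distinct : Unique c
      cyclic   : ∀ j → lookup π (lookup c j) ≡ suc (toℕ (lookup c (shift 1 j)))

  _≈rot_ : {A : Set} → Vec A m → Vec A m → Set
  c ≈rot d = ∃[ r ] (∀ j → lookup d j ≡ lookup c (shift r j))

  toℕ-shift : ∀ r j → toℕ (shift r j) ≡ (toℕ j + r) % m
  toℕ-shift r j = toℕ-fromℕ< (m%n<n (toℕ j + r) m)

  shift-multiple : ∀ q j → shift (q * m) j ≡ j
  shift-multiple q j = toℕ-injective (begin
    toℕ (shift (q * m) j)  ≡⟨ toℕ-shift (q * m) j ⟩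
    (toℕ j + q * m) % m    ≡⟨ [m+kn]%n≡m%n (toℕ j) q m ⟩
    toℕ j % m              ≡⟨ m<n⇒m%n≡m (toℕ<n j) ⟩
    toℕ j                  ∎)

  shift-shift : ∀ r s j → shift r (shift s j) ≡ shift (s + r) j
  shift-shift r s j = toℕ-injective (begin
    toℕ (shift r (shift s j))                ≡⟨ toℕ-shift r (shift s j) ⟩
    (toℕ (shift s j) + r) % m                ≡⟨ cong (λ x → (x + r) % m) (toℕ-shift s j) ⟩
    ((toℕ j + s) % m + r) % m                ≡⟨ %-distribˡ-+ ((toℕ j + s) % m) r m ⟩
    ((toℕ j + s) % m % m + r % m) % m        ≡⟨ cong (λ x → (x + r % m) % m) (m%n%n≡m%n (toℕ j + s) m) ⟩
    ((toℕ j + s) % m + r % m) % m            ≡⟨ %-distribˡ-+ (toℕ j + s) r m ⟨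
    (toℕ j + s + r) % m                      ≡⟨ cong (_% m) (+-assoc (toℕ j) s r) ⟩
    (toℕ j + (s + r)) % m                    ≡⟨ toℕ-shift (s + r) j ⟨
    toℕ (shift (s + r) j)                    ∎)

  ≈rot-isEquivalence : {A : Set} → IsEquivalence (_≈rot_ {A})
  ≈rot-isEquivalence {A} = record
    { refl  = λ {c} → 0 , λ j → cong (lookup c) (sym (shift-multiple 0 j))
    ; sym   = λ {c} {d} (r , p) → r * pred m , λ j → begin
        lookup c j                              ≡⟨ cong (lookup c) (shift-multiple r j) ⟨
        lookup c (shift (r * m) j)              ≡⟨ cong (λ x → lookup c (shift x j)) (split r m) ⟨
        lookup c (shift (r * pred m + r) j)     ≡⟨ cong (lookup c) (shift-shift r (r * pred m) j) ⟨
        lookup c (shift r (shift (r * pred m) j)) ≡⟨ p (shift (r * pred m) j) ⟨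
        lookup d (shift (r * pred m) j)         ∎
    ; trans = λ {c} {d} {e} (r , p) (s , q) → s + r , λ j → begin
        lookup e j                    ≡⟨ q j ⟩
        lookup d (shift s j)          ≡⟨ p (shift s j) ⟩
        lookup c (shift r (shift s j)) ≡⟨ cong (lookup c) (shift-shift r s j) ⟩
        lookup c (shift (s + r) j)    ∎
    }
    where
    split : ∀ r k .{{_ : NonZero k}} → r * pred k + r ≡ r * k
    split r (suc k) = begin
      r * k + r    ≡⟨ +-comm (r * k) r ⟩
      r + r * k    ≡⟨ cong (r +_) (*-comm r k) ⟩
      r + k * r    ≡⟨ *-comm (suc k) r ⟩
      r * suc k    ∎

rotationSetoid : Set → (m : ℕ) → .{{NonZero m}} → Setoid 0ℓ 0ℓ
rotationSetoid A m = record
  { Carrier       = Vec A m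
  ; _≈_           = _≈rot_
  ; isEquivalence = ≈rot-isEquivalence
  }

HasExactlyCycles : {n : ℕ} → Vec ℕ n → (k m : ℕ) → .{{NonZero m}} → Set
HasExactlyCycles {n} π k m = HasCardinality (rotationSetoid (Fin n) m) (IsCycle π) k

-- N! / (a₁! ⋯ aᵣ!), meaningful as a multinomial coefficient when a₁ + ⋯ + aᵣ = N.
multinomial : ℕ → List ℕ → ℚ
multinomial N as = (ℤ.+ (N !)) ℚ./ product (map _! as)
  where instance
    nonZero : NonZero (product (map _! as))
    nonZero = product≢0 (map⁺ (universal _!≢0 as))

sumℚ : List ℚ → ℚ
sumℚ = foldr ℚ._+_ 0ℚ

summand : (n m k ℓ : ℕ) → ℚ
summand n m k ℓ =
  ((ℤ.-1ℤ ℤ.^ ℓ) ℚ./ 1)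
  ℚ.* ((ℤ.+ (((m ∸ 1) !) ^ (k + ℓ))) ℚ./ (k ! * ℓ !))
  ℚ.* multinomial (n ∸ 1) (replicate (k + ℓ) m ∷ʳ (n ∸ (k + ℓ) * m ∸ 1))
  ℚ.* ((ℤ.+ ((n ∸ 1) ^ (n ∸ (k + ℓ) * m ∸ 1))) ℚ./ 1)
  where instance
    nonZero : NonZero (k ! * ℓ !)
    nonZero = m*n≢0 (k !) (ℓ !) {{k !≢0}} {{ℓ !≢0}}

-- For n, m ≥ 1 the condition (k + ℓ) m ≤ n - 1 forces ℓ < n, so searching
-- ℓ ∈ {0, …, n - 1} loses no index.
cycleSum : (n m k : ℕ) → ℚ
cycleSum n m k =
  sumℚ (map (summand n m k) (filter (λ ℓ → (k + ℓ) * m ≤? n ∸ 1) (upTo n)))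

{-# OPTIONS --safe #-}

-- A cycle of a prime parking function of length N + 1 avoids the index N + 1, because all entries are
-- at most N.  Conjugating a function {1, …, N + 1} → {1, …, N} by a rotation of {1, …, N} preserves its
-- cycle structure and, by the cycle lemma, exactly one of the N conjugates is a prime parking function.
-- Normalising instead the image of N + 1 to 1 makes prime parking functions with k m-cycles equinumerous
-- with functions {1, …, N} → {1, …, N} with k m-cycles.  For the latter, double counting the pairs of a
-- function f and s disjoint m-cycles of f with marked starting points gives
--   Σ_f mˢ c(f) (c(f) - 1) ⋯ (c(f) - s + 1) = N! / (N - sm)! · N^(N - sm),
-- where c(f) is the number of m-cycles, and binomial inversion turns this into the alternating sum.
module Submission where

open import Defs
open import Algebra.Properties.CommutativeSemigroup using (interchange; x∙yz≈y∙xz)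
open import Data.Bool using (true; false; if_then_else_)
open import Data.Fin as Fin using (Fin; zero; suc; toℕ; fromℕ<; inject₁)
import Data.Fin.Properties as Fin
open import Data.Integer as ℤ using (ℤ)
import Data.Integer.Properties as ℤ
open import Data.Integer.Solver using () renaming (module +-*-Solver to ℤ-Solver)
open import Data.List as List
  using (List; []; _∷_; _++_; length; map; filter; upTo; allFin; cartesianProductWith; deduplicate; replicate; _∷ʳ_)
import Data.List.Properties as List
open import Data.List.Membership.Propositional using (_∈_; _∉_)
open import Data.List.Membership.Propositional.Properties
  using (∈-map⁺; ∈-map⁻; ∈-filter⁺; ∈-filter⁻; ∈-allFin; ∈-cartesianProductWith⁺; ∈-++⁺ˡ; ∈-++⁺ʳ; ∈-++⁻; ∈-deduplicate⁻)
open import Data.List.Membership.Propositional.Properties.WithK using (unique∧set⇒bag)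
import Data.List.Membership.Setoid.Properties as SetoidMembership
open import Data.List.Relation.Binary.BagAndSetEquality using (∼bag⇒↭)
open import Data.List.Relation.Binary.Disjoint.Propositional using (Disjoint)
open import Data.List.Relation.Binary.Permutation.Propositional using (_↭_)
import Data.List.Relation.Binary.Permutation.Propositional.Properties as Perm
open import Data.List.Relation.Unary.All as All using (All; []; _∷_)
import Data.List.Relation.Unary.All.Properties as All
open import Data.List.Relation.Unary.AllPairs as AllPairs using (AllPairs; []; _∷_)
open import Data.List.Relation.Unary.Any as Any using (Any; here; there)
import Data.List.Relation.Unary.Any.Properties as Any
open import Data.List.Relation.Unary.Sorted.TotalOrder using (Sorted)
open import Data.List.Relation.Unary.Sorted.TotalOrder.Properties using (Sorted⇒AllPairs)
open import Data.List.Relation.Unary.Unique.Propositional using (Unique)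
import Data.List.Relation.Unary.Unique.Propositional.Properties as Unique
import Data.List.Relation.Unary.Unique.DecPropositional as DecUnique
import Data.List.Relation.Unary.Unique.DecSetoid.Properties as DecSetoidUnique
open import Data.List.Sort using (sort; sort-↭; sort-↗)
open import Data.Nat hiding (_/_)
-- Both operators have precedence 6.5 in the library, so they would bind weaker than _*_.
open import Data.Nat.Combinatorics using (nCk≡nPk/k!; nCk+nC[k+1]≡[n+1]C[k+1]; nCn≡1) renaming (_C_ to infixl 8 _C_)
open import Data.Nat.Combinatorics.Base as Combinatorics using () renaming (_P′_ to infixl 8 _↓_)
open import Data.Nat.Combinatorics.Specification using (k!∣nP′k; k>n⇒nCk≡0)
open import Data.Nat.DivMod as DivMod
  using (_mod_; _%_; /-congˡ; m/n*n≡m; m%n<n; m<n⇒m%n≡m; [m+n]%n≡m%n; %-distribˡ-+; m%n%n≡m%n)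
open import Data.Nat.ListAction using (sum; product)
import Data.Nat.ListAction.Properties as ListAction
open import Data.Nat.Properties
open import Data.Nat.Solver using (module +-*-Solver)
open import Data.Product using (∃-syntax; _×_; _,_; proj₁; proj₂)
open import Data.Rational as ℚ using (ℚ)
import Data.Rational.Properties as ℚ
import Data.Rational.Unnormalised as ℚᵘ
import Data.Rational.Unnormalised.Properties as ℚᵘ
open import Data.Sum as Sum using (_⊎_; inj₁; inj₂)
open import Data.Vec as Vec using (Vec; []; _∷_; lookup; tabulate; toList; _[_]≔_)
import Data.Vec.Properties as Vec
import Data.Vec.Relation.Unary.All as VecAll
import Data.Vec.Relation.Unary.All.Properties as VecAll
import Data.Vec.Relation.Unary.AllPairs as VecAllPairs
import Data.Vec.Relation.Unary.Unique.Propositional as VecUnique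
import Data.Vec.Relation.Unary.Unique.Propositional.Properties as VecUnique
open import Function using (_∘_; id; mk⇔)
open import Relation.Binary using (Setoid; DecSetoid; Tri; tri<; tri≈; tri>)
open import Relation.Binary.PropositionalEquality
  using (_≡_; refl; sym; trans; cong; cong₂; subst; setoid; module ≡-Reasoning)
open import Relation.Nullary using (¬_; Dec; yes; no; does; contradiction; _×-dec_; ¬?)
import Relation.Nullary.Decidable as Dec
open import Relation.Unary using (Pred; Decidable)

-- Conjugation permutes positions as well as values, but primality depends only on the multiset of
-- values, and on it conjugation acts as a translation modulo N. There are N + 1 values for N
-- residues, so the partial sums of the multiplicities grow by N + 1 over a period of length N: this
-- surplus of one singles out a unique rotation. The N conjugates of a function also send N + 1 to N
-- different values, so each orbit contains exactly one function that sends N + 1 to 1; forgetting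
-- that image loses no cycle, because N + 1 lies on none. Both normal forms are thus transversals of
-- the same orbits, and no division by N occurs. The factor ((m - 1)!)^s of the formula is the
-- (m!)^s of the multinomial denominator divided by the m^s choices of starting points. Working with
-- pointed cycles, that is with tuples instead of rotation classes, keeps all counts in ℕ as plain
-- sums over enumerated vectors.

private variable
  X Y Z : Set

-- Finite sums, indicators and enumerations

∑ : List X → (X → ℕ) → ℕ
∑ xs f = sum (map f xs)

𝟙 : {P : Set} → Dec P → ℕ
𝟙 p = if does p then 1 else 0

𝟙-yes : {P : Set} (p : Dec P) → P → 𝟙 p ≡ 1
𝟙-yes (yes _) _ = refl
𝟙-yes (no ¬p) p = contradiction p ¬p

𝟙-no : {P : Set} (p : Dec P) → ¬ P → 𝟙 p ≡ 0
𝟙-no (yes p) ¬p = contradiction p ¬p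
𝟙-no (no _)  _  = refl

𝟙-cong : {P Q : Set} (p : Dec P) (q : Dec Q) → (P → Q) → (Q → P) → 𝟙 p ≡ 𝟙 q
𝟙-cong (yes p) q f g = sym (𝟙-yes q (f p))
𝟙-cong (no ¬p) q f g = sym (𝟙-no q (¬p ∘ g))

𝟙-× : {P Q : Set} (p : Dec P) (q : Dec Q) → 𝟙 (p ×-dec q) ≡ 𝟙 p * 𝟙 q
𝟙-× (yes _) (yes _) = refl
𝟙-× (yes _) (no _)  = refl
𝟙-× (no _)  _       = refl

𝟙-¬ : {P : Set} (p : Dec P) → 𝟙 p + 𝟙 (¬? p) ≡ 1
𝟙-¬ (yes _) = refl
𝟙-¬ (no _)  = refl

-- Allows a count that is valid only for admissible objects to be substituted inside a sum over all
-- objects.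
𝟙-guard : {P : Set} (p : Dec P) {a b : ℕ} → (P → a ≡ b) → 𝟙 p * a ≡ 𝟙 p * b
𝟙-guard (yes p) eq = cong (_+ 0) (eq p)
𝟙-guard (no _)  eq = refl

∑-cong-∈ : ∀ (xs : List X) {f g : X → ℕ} → (∀ x → x ∈ xs → f x ≡ g x) → ∑ xs f ≡ ∑ xs g
∑-cong-∈ []       eq = refl
∑-cong-∈ (x ∷ xs) eq = cong₂ _+_ (eq x (here refl)) (∑-cong-∈ xs (λ y → eq y ∘ there))

∑-cong : ∀ (xs : List X) {f g : X → ℕ} → (∀ x → f x ≡ g x) → ∑ xs f ≡ ∑ xs g
∑-cong xs eq = ∑-cong-∈ xs (λ x _ → eq x)

∑-+ : ∀ (xs : List X) (f g : X → ℕ) → ∑ xs (λ x → f x + g x) ≡ ∑ xs f + ∑ xs g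
∑-+ []       f g = refl
∑-+ (x ∷ xs) f g = begin
  f x + g x + ∑ xs (λ y → f y + g y) ≡⟨ cong ((f x + g x) +_) (∑-+ xs f g) ⟩
  f x + g x + (∑ xs f + ∑ xs g)      ≡⟨ interchange +-commutativeSemigroup (f x) (g x) (∑ xs f) (∑ xs g) ⟩
  f x + ∑ xs f + (g x + ∑ xs g)      ∎
  where open ≡-Reasoning

∑-*ˡ : ∀ (xs : List X) c (f : X → ℕ) → ∑ xs (λ x → c * f x) ≡ c * ∑ xs f
∑-*ˡ []       c f = sym (*-zeroʳ c)
∑-*ˡ (x ∷ xs) c f = begin
  c * f x + ∑ xs (λ y → c * f y) ≡⟨ cong (c * f x +_) (∑-*ˡ xs c f) ⟩
  c * f x + c * ∑ xs f           ≡⟨ *-distribˡ-+ c (f x) (∑ xs f) ⟨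
  c * (f x + ∑ xs f)             ∎
  where open ≡-Reasoning

∑-*ʳ : ∀ (xs : List X) (f : X → ℕ) c → ∑ xs (λ x → f x * c) ≡ ∑ xs f * c
∑-*ʳ xs f c = begin
  ∑ xs (λ x → f x * c) ≡⟨ ∑-cong xs (λ x → *-comm (f x) c) ⟩
  ∑ xs (λ x → c * f x) ≡⟨ ∑-*ˡ xs c f ⟩
  c * ∑ xs f           ≡⟨ *-comm c (∑ xs f) ⟩
  ∑ xs f * c           ∎
  where open ≡-Reasoning

∑-const : ∀ (xs : List X) c → ∑ xs (λ _ → c) ≡ length xs * c
∑-const []       c = refl
∑-const (x ∷ xs) c = cong (c +_) (∑-const xs c)

∑-swap : ∀ (xs : List X) (ys : List Y) (f : X → Y → ℕ) →
         ∑ xs (λ x → ∑ ys (f x)) ≡ ∑ ys (λ y → ∑ xs (λ x → f x y))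
∑-swap []       ys f = sym (trans (∑-const ys 0) (*-zeroʳ (length ys)))
∑-swap (x ∷ xs) ys f = begin
  ∑ ys (f x) + ∑ xs (λ x → ∑ ys (f x))             ≡⟨ cong (∑ ys (f x) +_) (∑-swap xs ys f) ⟩
  ∑ ys (f x) + ∑ ys (λ y → ∑ xs (λ x → f x y))     ≡⟨ ∑-+ ys (f x) _ ⟨
  ∑ ys (λ y → f x y + ∑ xs (λ x → f x y))          ∎
  where open ≡-Reasoning

∑-++ : ∀ (xs ys : List X) (f : X → ℕ) → ∑ (xs ++ ys) f ≡ ∑ xs f + ∑ ys f
∑-++ xs ys f = trans (cong sum (List.map-++ f xs ys)) (ListAction.sum-++ (map f xs) (map f ys))

∑-map : ∀ (xs : List X) (g : X → Y) (f : Y → ℕ) → ∑ (map g xs) f ≡ ∑ xs (f ∘ g)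
∑-map xs g f = cong sum (sym (List.map-∘ xs))

∑-cartesianProductWith : ∀ (h : X → Y → Z) xs ys (f : Z → ℕ) →
  ∑ (cartesianProductWith h xs ys) f ≡ ∑ xs (λ x → ∑ ys (λ y → f (h x y)))
∑-cartesianProductWith h []       ys f = refl
∑-cartesianProductWith h (x ∷ xs) ys f = begin
  ∑ (map (h x) ys ++ cartesianProductWith h xs ys) f
    ≡⟨ ∑-++ (map (h x) ys) _ f ⟩
  ∑ (map (h x) ys) f + ∑ (cartesianProductWith h xs ys) f
    ≡⟨ cong₂ _+_ (∑-map ys (h x) f) (∑-cartesianProductWith h xs ys f) ⟩
  ∑ ys (f ∘ h x) + ∑ xs (λ x → ∑ ys (λ y → f (h x y))) ∎
  where open ≡-Reasoning

∑-↭ : ∀ {xs ys : List X} (f : X → ℕ) → xs ↭ ys → ∑ xs f ≡ ∑ ys f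
∑-↭ f p = ListAction.sum-↭ (Perm.map⁺ f p)

term≤∑ : ∀ {xs : List X} {x} (f : X → ℕ) → x ∈ xs → f x ≤ ∑ xs f
term≤∑ {xs = y ∷ xs} f (here refl) = m≤m+n (f y) (∑ xs f)
term≤∑ {xs = y ∷ xs} f (there p)   = ≤-trans (term≤∑ f p) (m≤n+m (∑ xs f) (f y))

length-filter : {P : Pred X _} (P? : Decidable P) (xs : List X) →
                length (filter P? xs) ≡ ∑ xs (𝟙 ∘ P?)
length-filter P? []       = refl
length-filter P? (x ∷ xs) with P? x
... | yes _ = cong suc (length-filter P? xs)
... | no  _ = length-filter P? xs

unique-⇔⇒↭ : {xs ys : List X} → Unique xs → Unique ys →
             (∀ {z} → z ∈ xs → z ∈ ys) → (∀ {z} → z ∈ ys → z ∈ xs) → xs ↭ ys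
unique-⇔⇒↭ u v f g = ∼bag⇒↭ (unique∧set⇒bag u v (mk⇔ f g))

record Enumerates (xs : List X) : Set where
  field
    unique   : Unique xs
    complete : ∀ x → x ∈ xs

allFin-enumerates : ∀ n → Enumerates (allFin n)
allFin-enumerates n = record { unique = Unique.allFin⁺ n ; complete = ∈-allFin }

length-allFin : ∀ n → length (allFin n) ≡ n
length-allFin n = List.length-tabulate {n = n} id

vecs : List X → ∀ n → List (Vec X n)
vecs xs zero    = [] ∷ []
vecs xs (suc n) = cartesianProductWith _∷_ xs (vecs xs n)

vecs-enumerates : {xs : List X} → Enumerates xs → ∀ n → Enumerates (vecs xs n)
vecs-enumerates e zero    = record { unique = [] ∷ [] ; complete = λ { [] → here refl } }
vecs-enumerates e (suc n) = record
  { unique   = Unique.cartesianProductWith⁺ _∷_ Vec.∷-injective (Enumerates.unique e) (Enumerates.unique es)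
  ; complete = λ { (x ∷ v) → ∈-cartesianProductWith⁺ _∷_ (Enumerates.complete e x) (Enumerates.complete es v) }
  }
  where es = vecs-enumerates e n

∑-vecs-suc : ∀ (xs : List X) n (f : Vec X (suc n) → ℕ) →
             ∑ (vecs xs (suc n)) f ≡ ∑ xs (λ x → ∑ (vecs xs n) (λ v → f (x ∷ v)))
∑-vecs-suc xs n f = ∑-cartesianProductWith _∷_ xs (vecs xs n) f

∑-vecs-1 : ∀ (xs : List X) n → ∑ (vecs xs n) (λ _ → 1) ≡ length xs ^ n
∑-vecs-1 xs zero    = refl
∑-vecs-1 xs (suc n) = begin
  ∑ (vecs xs (suc n)) (λ _ → 1)          ≡⟨ ∑-vecs-suc xs n (λ _ → 1) ⟩
  ∑ xs (λ _ → ∑ (vecs xs n) (λ _ → 1))   ≡⟨ ∑-const xs _ ⟩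
  length xs * ∑ (vecs xs n) (λ _ → 1)    ≡⟨ cong (length xs *_) (∑-vecs-1 xs n) ⟩
  length xs ^ suc n                      ∎
  where open ≡-Reasoning

-- Each vector arises as an update `v [ i ]≔ x` once for every value that the overwritten entry of
-- `v` may have had.
∑-update : ∀ (xs : List X) {n} (i : Fin n) (F : Vec X n → ℕ) →
           ∑ (vecs xs n) (λ v → ∑ xs (λ x → F (v [ i ]≔ x))) ≡ length xs * ∑ (vecs xs n) F
∑-update xs {suc n} zero F = begin
  ∑ (vecs xs (suc n)) (λ v → ∑ xs (λ x → F (v [ zero ]≔ x)))
    ≡⟨ ∑-vecs-suc xs n _ ⟩
  ∑ xs (λ _ → ∑ (vecs xs n) (λ v → ∑ xs (λ x → F (x ∷ v))))
    ≡⟨ ∑-const xs _ ⟩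
  length xs * ∑ (vecs xs n) (λ v → ∑ xs (λ x → F (x ∷ v)))
    ≡⟨ cong (length xs *_) (∑-swap xs (vecs xs n) (λ x v → F (x ∷ v))) ⟨
  length xs * ∑ xs (λ x → ∑ (vecs xs n) (λ v → F (x ∷ v)))
    ≡⟨ cong (length xs *_) (∑-vecs-suc xs n F) ⟨
  length xs * ∑ (vecs xs (suc n)) F ∎
  where open ≡-Reasoning
∑-update xs {suc n} (suc i) F = begin
  ∑ (vecs xs (suc n)) (λ v → ∑ xs (λ x → F (v [ suc i ]≔ x)))
    ≡⟨ ∑-vecs-suc xs n _ ⟩
  ∑ xs (λ y → ∑ (vecs xs n) (λ v → ∑ xs (λ x → F (y ∷ (v [ i ]≔ x)))))
    ≡⟨ ∑-cong xs (λ y → ∑-update xs i (λ v → F (y ∷ v))) ⟩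
  ∑ xs (λ y → length xs * ∑ (vecs xs n) (λ v → F (y ∷ v)))
    ≡⟨ ∑-*ˡ xs (length xs) _ ⟩
  length xs * ∑ xs (λ y → ∑ (vecs xs n) (λ v → F (y ∷ v)))
    ≡⟨ cong (length xs *_) (∑-vecs-suc xs n F) ⟨
  length xs * ∑ (vecs xs (suc n)) F ∎
  where open ≡-Reasoning

count-bijection : {P : Pred X _} {Q : Pred Y _} (P? : Decidable P) (Q? : Decidable Q)
  {xs : List X} {ys : List Y} → Enumerates xs → Enumerates ys →
  (φ : X → Y) → (∀ {x y} → φ x ≡ φ y → x ≡ y) →
  (∀ x → P x → Q (φ x)) → (∀ y → Q y → ∃[ x ] (P x × φ x ≡ y)) →
  ∑ xs (𝟙 ∘ P?) ≡ ∑ ys (𝟙 ∘ Q?)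
count-bijection P? Q? {xs} {ys} ex ey φ inj to from = begin
  ∑ xs (𝟙 ∘ P?)                  ≡⟨ length-filter P? xs ⟨
  length (filter P? xs)          ≡⟨ List.length-map φ (filter P? xs) ⟨
  length (map φ (filter P? xs))  ≡⟨ Perm.↭-length images ⟩
  length (filter Q? ys)          ≡⟨ length-filter Q? ys ⟩
  ∑ ys (𝟙 ∘ Q?)                  ∎
  where
  open ≡-Reasoning
  images : map φ (filter P? xs) ↭ filter Q? ys
  images = unique-⇔⇒↭ (Unique.map⁺ inj (Unique.filter⁺ P? (Enumerates.unique ex))) (Unique.filter⁺ Q? (Enumerates.unique ey))
    (λ z∈ → let (x , x∈ , eq) = ∈-map⁻ φ z∈
            in subst (_∈ _) (sym eq) (∈-filter⁺ Q? (Enumerates.complete ey (φ x)) (to x (proj₂ (∈-filter⁻ P? {xs = xs} x∈)))))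
    (λ {z} z∈ → let (x , px , eq) = from z (proj₂ (∈-filter⁻ Q? {xs = ys} z∈))
            in subst (_∈ _) eq (∈-map⁺ φ (∈-filter⁺ P? (Enumerates.complete ex x) px)))

count-∈ : {xs ys : List X} → Enumerates xs → Unique ys → (∈? : Decidable (_∈ ys)) →
          ∑ xs (𝟙 ∘ ∈?) ≡ length ys
count-∈ {xs = xs} {ys} e u ∈? = trans (sym (length-filter ∈? xs)) (Perm.↭-length
  (unique-⇔⇒↭ (Unique.filter⁺ ∈? (Enumerates.unique e)) u
    (λ z∈ → proj₂ (∈-filter⁻ ∈? {xs = xs} z∈)) (λ {z} z∈ → ∈-filter⁺ ∈? (Enumerates.complete e z) z∈)))

∑-reindex : ∀ {xs : List X} → Enumerates xs → (φ ψ : X → X) →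
            (∀ x → φ (ψ x) ≡ x) → (∀ x → ψ (φ x) ≡ x) → (f : X → ℕ) → ∑ xs (f ∘ φ) ≡ ∑ xs f
∑-reindex {xs = xs} e φ ψ φψ ψφ f = trans (sym (∑-map xs φ f)) (∑-↭ f
  (unique-⇔⇒↭ (Unique.map⁺ (λ {x} {y} eq → trans (sym (ψφ x)) (trans (cong ψ eq) (ψφ y))) (Enumerates.unique e)) (Enumerates.unique e)
    (λ {z} _ → Enumerates.complete e z) (λ {z} _ → subst (_∈ _) (φψ z) (∈-map⁺ φ (Enumerates.complete e (ψ z))))))

𝟙-⊎ : {P Q R : Set} (p : Dec P) (q : Dec Q) (r : Dec R) →
      (P → R) → (Q → R) → (R → P ⊎ Q) → ¬ (P × Q) → 𝟙 r ≡ 𝟙 p + 𝟙 q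
𝟙-⊎ (yes p) (yes q) r f g h d = contradiction (p , q) d
𝟙-⊎ (yes p) (no ¬q) r f g h d = 𝟙-yes r (f p)
𝟙-⊎ (no ¬p) (yes q) r f g h d = 𝟙-yes r (g q)
𝟙-⊎ (no ¬p) (no ¬q) r f g h d = 𝟙-no r λ x → Sum.[ ¬p , ¬q ] (h x)

-- Rotations of tuples and pointed cycles

lookup-extensional : {A : Set} {n : ℕ} {v w : Vec A n} → (∀ i → lookup v i ≡ lookup w i) → v ≡ w
lookup-extensional {v = v} {w} eq =
  trans (sym (Vec.tabulate∘lookup v)) (trans (Vec.tabulate-cong eq) (Vec.tabulate∘lookup w))

unique-from-injective : {A : Set} {n : ℕ} (v : Vec A n) →
  (∀ {i j} → lookup v i ≡ lookup v j → i ≡ j) → VecUnique.Unique v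
unique-from-injective v inj = subst VecUnique.Unique (Vec.tabulate∘lookup v) (VecUnique.tabulate⁺ inj)

module _ {m : ℕ} .{{_ : NonZero m}} where

  shift-≡ : ∀ r s (i j : Fin m) → (toℕ i + r) % m ≡ (toℕ j + s) % m → shift r i ≡ shift s j
  shift-≡ r s i j eq = Fin.toℕ-injective (trans (toℕ-shift r i) (trans eq (sym (toℕ-shift s j))))

  shift-comm : ∀ r s (i : Fin m) → shift r (shift s i) ≡ shift s (shift r i)
  shift-comm r s i = trans (shift-shift r s i)
    (trans (cong (λ x → shift x i) (+-comm s r)) (sym (shift-shift s r i)))

  -- Both sides are i + j modulo m. The exchange of point and amount makes `shift-injective`
  -- applicable to the amount as well.
  shift-swap : ∀ (i j : Fin m) → shift (toℕ i) j ≡ shift (toℕ j) i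
  shift-swap i j = shift-≡ (toℕ i) (toℕ j) j i (cong (_% m) (+-comm (toℕ j) (toℕ i)))

  n+n*pred[m]≡n*m : ∀ n → n + n * pred m ≡ n * m
  n+n*pred[m]≡n*m n = trans (sym (*-suc n (pred m))) (cong (n *_) (suc-pred m))

  -- The amount `r * pred m` stands for -r modulo m, for r of any size and without truncated
  -- subtraction.
  shift-inverseˡ : ∀ r (i : Fin m) → shift (r * pred m) (shift r i) ≡ i
  shift-inverseˡ r i = begin
    shift (r * pred m) (shift r i) ≡⟨ shift-shift (r * pred m) r i ⟩
    shift (r + r * pred m) i       ≡⟨ cong (λ x → shift x i) (n+n*pred[m]≡n*m r) ⟩
    shift (r * m) i                ≡⟨ shift-multiple r i ⟩
    i                              ∎
    where open ≡-Reasoning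

  shift-inverseʳ : ∀ r (i : Fin m) → shift r (shift (r * pred m) i) ≡ i
  shift-inverseʳ r i = trans (shift-comm r (r * pred m) i) (shift-inverseˡ r i)

  shift-injective : ∀ r {i j : Fin m} → shift r i ≡ shift r j → i ≡ j
  shift-injective r {i} {j} eq =
    trans (sym (shift-inverseˡ r i)) (trans (cong (shift (r * pred m)) eq) (shift-inverseˡ r j))

  shift-mod : ∀ r (i : Fin m) → shift (toℕ (r mod m)) i ≡ shift r i
  shift-mod r i = shift-≡ (toℕ (r mod m)) r i i (begin
    (toℕ i + toℕ (r mod m)) % m    ≡⟨ cong (λ x → (toℕ i + x) % m) (Fin.toℕ-fromℕ< (m%n<n r m)) ⟩
    (toℕ i + r % m) % m            ≡⟨ %-distribˡ-+ (toℕ i) (r % m) m ⟩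
    (toℕ i % m + r % m % m) % m    ≡⟨ cong (λ x → (toℕ i % m + x) % m) (m%n%n≡m%n r m) ⟩
    (toℕ i % m + r % m) % m        ≡⟨ %-distribˡ-+ (toℕ i) r m ⟨
    (toℕ i + r) % m                ∎)
    where open ≡-Reasoning

  -- The amount is j - i modulo m, with -i written as `toℕ i * pred m`.
  shift-reaches : ∀ (i j : Fin m) → shift (toℕ j + toℕ i * pred m) i ≡ j
  shift-reaches i j = trans
    (shift-≡ (toℕ j + toℕ i * pred m) (toℕ i * m) i j (cong (_% m) (begin
      toℕ i + (toℕ j + toℕ i * pred m)  ≡⟨ x∙yz≈y∙xz +-commutativeSemigroup (toℕ i) (toℕ j) _ ⟩
      toℕ j + (toℕ i + toℕ i * pred m)  ≡⟨ cong (toℕ j +_) (n+n*pred[m]≡n*m (toℕ i)) ⟩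
      toℕ j + toℕ i * m                 ∎)))
    (shift-multiple (toℕ i) j)
    where open ≡-Reasoning

  module _ {A : Set} where
    private module Rot = Setoid (rotationSetoid A m)

    ≈rot-refl : ∀ (c : Vec A m) → c ≈rot c
    ≈rot-refl c = Rot.refl {c}

    ≈rot-sym : ∀ (c d : Vec A m) → c ≈rot d → d ≈rot c
    ≈rot-sym c d = Rot.sym {c} {d}

    ≈rot-trans : ∀ (c d e : Vec A m) → c ≈rot d → d ≈rot e → c ≈rot e
    ≈rot-trans c d e = Rot.trans {c} {d} {e}

  rotate : {A : Set} → Vec A m → Fin m → Vec A m
  rotate c r = tabulate (λ j → lookup c (shift (toℕ r) j))

  rotations : {A : Set} → Vec A m → List (Vec A m)
  rotations c = map (rotate c) (allFin m)

  length-rotations : {A : Set} (c : Vec A m) → length (rotations c) ≡ m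
  length-rotations c = trans (List.length-map (rotate c) (allFin m)) (length-allFin m)

  -- The amount hidden in `_≈rot_` is an arbitrary natural number; its residue modulo m gives the
  -- same rotation, so m candidates suffice and the relation is decidable over `Fin n`.
  ≈rot⇒∈ : {A : Set} (c {d} : Vec A m) → c ≈rot d → d ∈ rotations c
  ≈rot⇒∈ c {d} (r , eq) = subst (_∈ rotations c)
    (lookup-extensional (λ j → begin
      lookup (rotate c (r mod m)) j        ≡⟨ Vec.lookup∘tabulate _ j ⟩
      lookup c (shift (toℕ (r mod m)) j)   ≡⟨ cong (lookup c) (shift-mod r j) ⟩
      lookup c (shift r j)                 ≡⟨ eq j ⟨
      lookup d j                           ∎))
    (∈-map⁺ (rotate c) (∈-allFin (r mod m)))
    where open ≡-Reasoning

  ∈⇒≈rot : {A : Set} (c {d} : Vec A m) → d ∈ rotations c → c ≈rot d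
  ∈⇒≈rot c d∈ with ∈-map⁻ (rotate c) d∈
  ... | r , _ , refl = toℕ r , Vec.lookup∘tabulate _

  rotations-unique : {A : Set} {c : Vec A m} → VecUnique.Unique c → Unique (rotations c)
  rotations-unique {c = c} u = Unique.map⁺ inj (Unique.allFin⁺ m)
    where
    open ≡-Reasoning
    inj : ∀ {r s} → rotate c r ≡ rotate c s → r ≡ s
    -- The rotations are compared at the position r: this yields r + r = s + r modulo m, and
    -- `shift-swap` turns the right side into a shift by r, which cancels.
    inj {r} {s} eq = shift-injective (toℕ r) (begin
      shift (toℕ r) r ≡⟨ VecUnique.lookup-injective u (shift (toℕ r) r) (shift (toℕ s) r) (begin
        lookup c (shift (toℕ r) r)  ≡⟨ Vec.lookup∘tabulate _ r ⟨
        lookup (rotate c r) r       ≡⟨ cong (λ v → lookup v r) eq ⟩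
        lookup (rotate c s) r       ≡⟨ Vec.lookup∘tabulate _ r ⟩
        lookup c (shift (toℕ s) r)  ∎) ⟩
      shift (toℕ s) r ≡⟨ shift-swap s r ⟩
      shift (toℕ r) s ∎)

  module _ {n : ℕ} where

    _≈rot?_ : (c d : Vec (Fin n) m) → Dec (c ≈rot d)
    c ≈rot? d = Dec.map′ (∈⇒≈rot c) (≈rot⇒∈ c) (Any.any? (Vec.≡-dec Fin._≟_ d) (rotations c))

    rotationDecSetoid : DecSetoid _ _
    rotationDecSetoid = record
      { isDecEquivalence = record
        { isEquivalence = Setoid.isEquivalence (rotationSetoid (Fin n) m)
        ; _≟_           = _≈rot?_
        }
      }

    blocks : List (Vec (Fin n) m)
    blocks = vecs (allFin n) m

    blocks-enumerate : Enumerates blocks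
    blocks-enumerate = vecs-enumerates (allFin-enumerates n) m

    count-rotations : ∀ {c : Vec (Fin n) m} → VecUnique.Unique c →
                      ∑ blocks (λ b → 𝟙 (c ≈rot? b)) ≡ m
    count-rotations {c} u = begin
      ∑ blocks (λ b → 𝟙 (c ≈rot? b))
        ≡⟨ ∑-cong blocks (λ b → 𝟙-cong (c ≈rot? b) (∈? b) (≈rot⇒∈ c) (∈⇒≈rot c)) ⟩
      ∑ blocks (𝟙 ∘ ∈?)
        ≡⟨ count-∈ blocks-enumerate (rotations-unique u) ∈? ⟩
      length (rotations c)
        ≡⟨ length-rotations c ⟩
      m ∎
      where
      open ≡-Reasoning
      ∈? : Decidable (_∈ rotations c)
      ∈? b = Any.any? (Vec.≡-dec Fin._≟_ b) (rotations c)

    _∈rot?_ : ∀ (b : Vec (Fin n) m) cs → Dec (Any (_≈rot b) cs)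
    b ∈rot? cs = Any.any? (_≈rot? b) cs

    -- Distinct entries give each rotation class exactly m members, and the classes of inequivalent
    -- tuples are disjoint.
    count-∈rot : ∀ {cs : List (Vec (Fin n) m)} → All VecUnique.Unique cs →
                 AllPairs (λ c d → ¬ c ≈rot d) cs →
                 ∑ blocks (λ b → 𝟙 (b ∈rot? cs)) ≡ length cs * m
    count-∈rot {[]}     []       []       = trans (∑-const blocks 0) (*-zeroʳ (length blocks))
    count-∈rot {c ∷ cs} (u ∷ us) (d ∷ ds) = begin
      ∑ blocks (λ b → 𝟙 (b ∈rot? (c ∷ cs)))
        ≡⟨ ∑-cong blocks (λ b → 𝟙-⊎ (c ≈rot? b) (b ∈rot? cs) (b ∈rot? (c ∷ cs))
             here there Any.toSum (exclusive b)) ⟩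
      ∑ blocks (λ b → 𝟙 (c ≈rot? b) + 𝟙 (b ∈rot? cs))
        ≡⟨ ∑-+ blocks _ _ ⟩
      ∑ blocks (λ b → 𝟙 (c ≈rot? b)) + ∑ blocks (λ b → 𝟙 (b ∈rot? cs))
        ≡⟨ cong₂ _+_ (count-rotations u) (count-∈rot us ds) ⟩
      m + length cs * m ∎
      where
      open ≡-Reasoning
      exclusive : ∀ b → ¬ (c ≈rot b × Any (_≈rot b) cs)
      exclusive b (c≈b , any) = All.All¬⇒¬Any d 
        (Any.map (λ {c′} c′≈b → ≈rot-trans c b c′ c≈b (≈rot-sym c′ b c′≈b)) any)

    module _ {π : Vec ℕ n} where

      -- An entry of `π` determines the next index of the cycle, so two cycles that meet run
      -- together from there on.
      cycles-in-step : ∀ {c d : Vec (Fin n) m} → IsCycle π c → IsCycle π d → ∀ {i j} →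
        lookup c i ≡ lookup d j → ∀ r → lookup c (shift r i) ≡ lookup d (shift r j)
      cycles-in-step {c} {d} pc pd {i} {j} eq zero    = begin
        lookup c (shift 0 i) ≡⟨ cong (lookup c) (shift-multiple 0 i) ⟩
        lookup c i           ≡⟨ eq ⟩
        lookup d j           ≡⟨ cong (lookup d) (shift-multiple 0 j) ⟨
        lookup d (shift 0 j) ∎
        where open ≡-Reasoning
      cycles-in-step {c} {d} pc pd {i} {j} eq (suc r) = Fin.toℕ-injective (suc-injective (begin
        suc (toℕ (lookup c (shift (suc r) i)))       ≡⟨ cong (suc ∘ toℕ ∘ lookup c) (step i) ⟨
        suc (toℕ (lookup c (shift 1 (shift r i))))   ≡⟨ IsCycle.cyclic pc (shift r i) ⟨
        lookup π (lookup c (shift r i))              ≡⟨ cong (lookup π) (cycles-in-step pc pd eq r) ⟩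
        lookup π (lookup d (shift r j))              ≡⟨ IsCycle.cyclic pd (shift r j) ⟩
        suc (toℕ (lookup d (shift 1 (shift r j))))   ≡⟨ cong (suc ∘ toℕ ∘ lookup d) (step j) ⟩
        suc (toℕ (lookup d (shift (suc r) j)))       ∎))
        where
        open ≡-Reasoning
        step : ∀ i → shift 1 (shift r i) ≡ shift (suc r) i
        step i = trans (shift-shift 1 r i) (cong (λ x → shift x i) (+-comm r 1))

      -- Position x of `d` lies x - j steps after the common entry, which is position i + x - j of
      -- `c`; the rotation amount is therefore i - j. Consequently inequivalent cycles are disjoint.
      meeting-cycles : ∀ {c d : Vec (Fin n) m} → IsCycle π c → IsCycle π d → ∀ {i j} →
                       lookup c i ≡ lookup d j → c ≈rot d
      meeting-cycles {c} {d} pc pd {i} {j} eq = r , λ x → begin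
        lookup d x                       ≡⟨ cong (lookup d) (shift-reaches j x) ⟨
        lookup d (shift (R x) j)         ≡⟨ cycles-in-step pc pd eq (R x) ⟨
        lookup c (shift (R x) i)         ≡⟨ cong (lookup c) (shift-≡ (R x) r i x (cong (_% m)
                                              (x∙yz≈y∙xz +-commutativeSemigroup (toℕ i) (toℕ x) _))) ⟩
        lookup c (shift r x)             ∎
        where
        open ≡-Reasoning
        r = toℕ i + toℕ j * pred m
        R : Fin m → ℕ
        R x = toℕ x + toℕ j * pred m

      rotation-isCycle : ∀ {c d : Vec (Fin n) m} → IsCycle π c → c ≈rot d → IsCycle π d
      rotation-isCycle {c} {d} pc (r , eq) = record
        { distinct = unique-from-injective d λ {i} {j} e → shift-injective r
            (VecUnique.lookup-injective (IsCycle.distinct pc) _ _ (trans (sym (eq i)) (trans e (eq j))))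
        ; cyclic   = λ j → begin
            lookup π (lookup d j)                       ≡⟨ cong (lookup π) (eq j) ⟩
            lookup π (lookup c (shift r j))             ≡⟨ IsCycle.cyclic pc (shift r j) ⟩
            suc (toℕ (lookup c (shift 1 (shift r j))))  ≡⟨ cong (suc ∘ toℕ ∘ lookup c) (shift-comm 1 r j) ⟩
            suc (toℕ (lookup c (shift r (shift 1 j))))  ≡⟨ cong (suc ∘ toℕ) (eq (shift 1 j)) ⟨
            suc (toℕ (lookup d (shift 1 j)))            ∎
        }
        where open ≡-Reasoning

    isCycle? : ∀ (π : Vec ℕ n) → Decidable (IsCycle {m} π)
    isCycle? π c = Dec.map′ (λ (u , z) → record { distinct = u ; cyclic = z })
      (λ p → IsCycle.distinct p , IsCycle.cyclic p)
      (VecAllPairs.allPairs? (λ x y → ¬? (x Fin.≟ y)) c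
        ×-dec Fin.all? (λ j → lookup π (lookup c j) ≟ suc (toℕ (lookup c (shift 1 j)))))

    -- Cycles are counted here as pointed cycles: an m-cycle contributes its m rotations.
    #cycles : Vec ℕ n → ℕ
    #cycles π = ∑ blocks (𝟙 ∘ isCycle? π)

    #cycles-exact : ∀ (π : Vec ℕ n) {k} → HasExactlyCycles π k m → #cycles π ≡ k * m
    #cycles-exact π {k} h = begin
      ∑ blocks (𝟙 ∘ isCycle? π)
        ≡⟨ ∑-cong blocks (λ b → 𝟙-cong (isCycle? π b) (b ∈rot? elements)
             (λ p → Any.map (λ {c} → ≈rot-sym b c) (complete b p))
             (λ any → let (p , r) = All.lookupAny sound any in
                      rotation-isCycle p r)) ⟩
      ∑ blocks (λ b → 𝟙 (b ∈rot? elements))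
        ≡⟨ count-∈rot (All.map IsCycle.distinct sound) distinct ⟩
      length elements * m
        ≡⟨ cong (_* m) size ⟩
      k * m ∎
      where
      open ≡-Reasoning
      open HasCardinality h

    cycles-countable : ∀ (π : Vec ℕ n) → ∃[ k ] HasExactlyCycles π k m
    cycles-countable π = length reps , record
      { elements = reps
      ; sound    = All.tabulate λ c∈ → proj₂ (∈-filter⁻ (isCycle? π) {xs = blocks}
          (∈-deduplicate⁻ _≈rot?_ cycles c∈))
      ; complete = λ c p → SetoidMembership.∈-deduplicate⁺ (rotationSetoid (Fin n) m) _≈rot?_
          (λ {x} {y} {z} z≈y x≈y → ≈rot-trans x y z x≈y (≈rot-sym z y z≈y))
          {z = c} (Any.map {Q = c ≈rot_} (λ { refl → ≈rot-refl c })
            (∈-filter⁺ (isCycle? π) (Enumerates.complete blocks-enumerate c) p))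
      ; distinct = DecSetoidUnique.deduplicate-! rotationDecSetoid cycles
      ; size     = refl
      }
      where
      cycles reps : List (Vec (Fin n) m)
      cycles = filter (isCycle? π) blocks
      reps   = deduplicate _≈rot?_ cycles

    -- Some number of cycles always exists by `cycles-countable`; since m is nonzero, the number of
    -- pointed cycles determines it. This reduces the cardinality record to an equation between
    -- natural numbers.
    #cycles-reflects : ∀ (π : Vec ℕ n) {k} → #cycles π ≡ k * m → HasExactlyCycles π k m
    #cycles-reflects π {k} eq = let (k′ , h) = cycles-countable π in
      subst (λ k → HasExactlyCycles π k m)
        (*-cancelʳ-≡ k′ k m (trans (sym (#cycles-exact π h)) eq)) h

-- Tuples with distinct entries and disjoint blocks

unique-++⁻ : {A : Set} (xs : List A) {ys : List A} → Unique (xs ++ ys) →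
             Unique xs × Unique ys × Disjoint xs ys
unique-++⁻ []       u        = [] , u , λ { (() , _) }
unique-++⁻ (x ∷ xs) (x∉ ∷ u) =
  let (u₁ , u₂ , d) = unique-++⁻ xs u in
  All.++⁻ˡ xs x∉ ∷ u₁ , u₂ , λ
    { (here refl , z∈) → All.lookup (All.++⁻ʳ xs x∉) z∈ refl
    ; (there z∈xs , z∈ys) → d (z∈xs , z∈ys) }

toList-unique⁺ : {A : Set} {n : ℕ} {v : Vec A n} → VecUnique.Unique v → Unique (toList v)
toList-unique⁺ VecAllPairs.[]      = []
toList-unique⁺ (x∉ VecAllPairs.∷ u) = VecAll.toList⁺ x∉ ∷ toList-unique⁺ u

toList-unique⁻ : {A : Set} {n : ℕ} {v : Vec A n} → Unique (toList v) → VecUnique.Unique v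
toList-unique⁻ {v = []}    []       = VecAllPairs.[]
toList-unique⁻ {v = _ ∷ _} (x∉ ∷ u) = VecAll.toList⁻ x∉ VecAllPairs.∷ toList-unique⁻ u

∈-toList⁻ : {A : Set} {n : ℕ} {x : A} (v : Vec A n) → x ∈ toList v → ∃[ i ] lookup v i ≡ x
∈-toList⁻ (x ∷ v) (here refl) = zero , refl
∈-toList⁻ (y ∷ v) (there x∈)  = let (i , eq) = ∈-toList⁻ v x∈ in suc i , eq

∈-toList⁺ : {A : Set} {n : ℕ} (v : Vec A n) (i : Fin n) → lookup v i ∈ toList v
∈-toList⁺ (x ∷ v) zero    = here refl
∈-toList⁺ (x ∷ v) (suc i) = there (∈-toList⁺ v i)

tabulate-lookup : {A : Set} {n : ℕ} (v : Vec A n) → List.tabulate (lookup v) ≡ toList v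
tabulate-lookup []      = refl
tabulate-lookup (x ∷ v) = cong (x ∷_) (tabulate-lookup v)

↓-+ : ∀ n a b → n ↓ (a + b) ≡ (n ∸ b) ↓ a * n ↓ b
↓-+ n zero    b = sym (+-identityʳ _)
↓-+ n (suc a) b = begin
  (n ∸ (a + b)) * n ↓ (a + b)              ≡⟨ cong₂ _*_ (trans (cong (n ∸_) (+-comm a b)) (sym (∸-+-assoc n b a))) (↓-+ n a b) ⟩
  (n ∸ b ∸ a) * ((n ∸ b) ↓ a * n ↓ b)     ≡⟨ *-assoc (n ∸ b ∸ a) _ _ ⟨
  (n ∸ b ∸ a) * (n ∸ b) ↓ a * n ↓ b       ∎
  where open ≡-Reasoning

module _ {N : ℕ} where

  unique? : Decidable (Unique {A = Fin N})
  unique? = DecUnique.unique? Fin._≟_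

  _∈?_ : (x : Fin N) (xs : List (Fin N)) → Dec (x ∈ xs)
  x ∈? xs = Any.any? (x Fin.≟_) xs

  𝟙-unique-∷ : ∀ x (xs : List (Fin N)) → 𝟙 (unique? (x ∷ xs)) ≡ 𝟙 (unique? xs) * 𝟙 (¬? (x ∈? xs))
  𝟙-unique-∷ x xs = trans
    (𝟙-cong (unique? (x ∷ xs)) (unique? xs ×-dec ¬? (x ∈? xs))
      (λ u → AllPairs.tail u , Unique.Unique[x∷xs]⇒x∉xs u)
      (λ (u , x∉) → All.¬Any⇒All¬ xs x∉ ∷ u))
    (𝟙-× (unique? xs) (¬? (x ∈? xs)))

  count-fresh : ∀ {xs : List (Fin N)} → Unique xs →
                ∑ (allFin N) (λ x → 𝟙 (¬? (x ∈? xs))) ≡ N ∸ length xs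
  count-fresh {xs} u = sym (begin
    N ∸ length xs                            ≡⟨ cong₂ _∸_ total (sym seen) ⟩
    (old + new) ∸ old                        ≡⟨ m+n∸m≡n old new ⟩
    new                                      ∎)
    where
    open ≡-Reasoning
    old = ∑ (allFin N) (λ x → 𝟙 (x ∈? xs))
    new = ∑ (allFin N) (λ x → 𝟙 (¬? (x ∈? xs)))
    seen : old ≡ length xs
    seen = count-∈ (allFin-enumerates N) u (_∈? xs)
    total : N ≡ old + new
    total = begin
      N                                                              ≡⟨ *-identityʳ N ⟨
      N * 1                                                          ≡⟨ cong (_* 1) (length-allFin N) ⟨
      length (allFin N) * 1                                          ≡⟨ ∑-const (allFin N) 1 ⟨
      ∑ (allFin N) (λ _ → 1)                                         ≡⟨ ∑-cong (allFin N) (λ x → sym (𝟙-¬ (x ∈? xs))) ⟩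
      ∑ (allFin N) (λ x → 𝟙 (x ∈? xs) + 𝟙 (¬? (x ∈? xs)))            ≡⟨ ∑-+ (allFin N) _ _ ⟩
      old + new                                                      ∎

  -- The head is chosen last: once the tail is fixed, it has to avoid the entries of the tail and of
  -- `xs`, and their number does not depend on the choice of the tail.
  count-unique-extensions : ∀ n (xs : List (Fin N)) →
    ∑ (vecs (allFin N) n) (λ v → 𝟙 (unique? (toList v ++ xs))) ≡ 𝟙 (unique? xs) * (N ∸ length xs) ↓ n
  count-unique-extensions zero    xs = trans (+-identityʳ _) (sym (*-identityʳ _))
  count-unique-extensions (suc n) xs = begin
    ∑ (vecs (allFin N) (suc n)) (λ v → 𝟙 (unique? (toList v ++ xs)))
      ≡⟨ ∑-vecs-suc (allFin N) n _ ⟩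
    ∑ (allFin N) (λ x → ∑ V (λ v → 𝟙 (unique? (x ∷ toList v ++ xs))))
      ≡⟨ ∑-swap (allFin N) V _ ⟩
    ∑ V (λ v → ∑ (allFin N) (λ x → 𝟙 (unique? (x ∷ toList v ++ xs))))
      ≡⟨ ∑-cong V (λ v → ∑-cong (allFin N) (λ x → 𝟙-unique-∷ x (toList v ++ xs))) ⟩
    ∑ V (λ v → ∑ (allFin N) (λ x → U v * 𝟙 (¬? (x ∈? (toList v ++ xs)))))
      ≡⟨ ∑-cong V (λ v → ∑-*ˡ (allFin N) (U v) _) ⟩
    ∑ V (λ v → U v * ∑ (allFin N) (λ x → 𝟙 (¬? (x ∈? (toList v ++ xs)))))
      ≡⟨ ∑-cong V (λ v → 𝟙-guard (unique? (toList v ++ xs)) (λ u → trans (count-fresh u) (fresh v))) ⟩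
    ∑ V (λ v → U v * (N ∸ length xs ∸ n))
      ≡⟨ ∑-*ʳ V U _ ⟩
    ∑ V U * (N ∸ length xs ∸ n)
      ≡⟨ cong (_* (N ∸ length xs ∸ n)) (count-unique-extensions n xs) ⟩
    𝟙 (unique? xs) * (N ∸ length xs) ↓ n * (N ∸ length xs ∸ n)
      ≡⟨ *-assoc (𝟙 (unique? xs)) _ _ ⟩
    𝟙 (unique? xs) * ((N ∸ length xs) ↓ n * (N ∸ length xs ∸ n))
      ≡⟨ cong (𝟙 (unique? xs) *_) (*-comm ((N ∸ length xs) ↓ n) _) ⟩
    𝟙 (unique? xs) * (N ∸ length xs) ↓ suc n ∎
    where
    open ≡-Reasoning
    V = vecs (allFin N) n
    U : Vec (Fin N) n → ℕ
    U v = 𝟙 (unique? (toList v ++ xs))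
    fresh : ∀ v → N ∸ length (toList v ++ xs) ≡ N ∸ length xs ∸ n
    fresh v = begin
      N ∸ length (toList v ++ xs)           ≡⟨ cong (N ∸_) (List.length-++ (toList v)) ⟩
      N ∸ (length (toList v) + length xs)   ≡⟨ cong (λ l → N ∸ (l + length xs)) (Vec.length-toList v) ⟩
      N ∸ (n + length xs)                   ≡⟨ cong (N ∸_) (+-comm n (length xs)) ⟩
      N ∸ (length xs + n)                   ≡⟨ ∸-+-assoc N (length xs) n ⟨
      N ∸ length xs ∸ n                     ∎

module _ {A : Set} {m : ℕ} where

  -- Concatenation makes `Unique (points bs)` express two things at once: every block has distinct
  -- entries, and the blocks are pairwise disjoint.
  points : ∀ {s} → Vec (Vec A m) s → List A
  points []       = []
  points (b ∷ bs) = toList b ++ points bs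

  length-points : ∀ {s} (bs : Vec (Vec A m) s) → length (points bs) ≡ s * m
  length-points []       = refl
  length-points (b ∷ bs) =
    trans (List.length-++ (toList b)) (cong₂ _+_ (Vec.length-toList b) (length-points bs))

  ∈-points⁻ : ∀ {s x} (bs : Vec (Vec A m) s) → x ∈ points bs → Any (λ b → x ∈ toList b) (toList bs)
  ∈-points⁻ (b ∷ bs) x∈ with ∈-++⁻ (toList b) x∈
  ... | inj₁ x∈b  = here x∈b
  ... | inj₂ x∈bs = there (∈-points⁻ bs x∈bs)

  ∈-points⁺ : ∀ {s x} (bs : Vec (Vec A m) s) → Any (λ b → x ∈ toList b) (toList bs) → x ∈ points bs
  ∈-points⁺ (b ∷ bs) (here x∈)  = ∈-++⁺ˡ x∈
  ∈-points⁺ (b ∷ bs) (there x∈) = ∈-++⁺ʳ (toList b) (∈-points⁺ bs x∈)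

count-disjoint-blocks : ∀ N m s →
  ∑ (vecs (vecs (allFin N) m) s) (λ bs → 𝟙 (unique? (points bs))) ≡ N ↓ (s * m)
count-disjoint-blocks N m zero    = refl
count-disjoint-blocks N m (suc s) = begin
  ∑ (vecs B (suc s)) (λ bs → 𝟙 (unique? (points bs)))
    ≡⟨ ∑-vecs-suc B s _ ⟩
  ∑ B (λ b → ∑ (vecs B s) (λ bs → 𝟙 (unique? (toList b ++ points bs))))
    ≡⟨ ∑-swap B (vecs B s) _ ⟩
  ∑ (vecs B s) (λ bs → ∑ B (λ b → 𝟙 (unique? (toList b ++ points bs))))
    ≡⟨ ∑-cong (vecs B s) (λ bs → trans (count-unique-extensions m (points bs))
         (cong (λ l → 𝟙 (unique? (points bs)) * (N ∸ l) ↓ m) (length-points bs))) ⟩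
  ∑ (vecs B s) (λ bs → 𝟙 (unique? (points bs)) * (N ∸ s * m) ↓ m)
    ≡⟨ ∑-*ʳ (vecs B s) _ _ ⟩
  ∑ (vecs B s) (λ bs → 𝟙 (unique? (points bs))) * (N ∸ s * m) ↓ m
    ≡⟨ cong (_* (N ∸ s * m) ↓ m) (count-disjoint-blocks N m s) ⟩
  N ↓ (s * m) * (N ∸ s * m) ↓ m
    ≡⟨ *-comm (N ↓ (s * m)) _ ⟩
  (N ∸ s * m) ↓ m * N ↓ (s * m)
    ≡⟨ ↓-+ N m (s * m) ⟨
  N ↓ (m + s * m) ∎
  where
  open ≡-Reasoning
  B = vecs (allFin N) m

-- Functions with prescribed values

module _ {M n : ℕ} where

  sends? : ∀ (f : Vec (Fin M) n) → Decidable (λ ((x , y) : Fin n × Fin M) → lookup f x ≡ y)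
  sends? f (x , y) = lookup f x Fin.≟ y

  satisfies? : ∀ (f : Vec (Fin M) n) → Decidable (All (λ ((x , y) : Fin n × Fin M) → lookup f x ≡ y))
  satisfies? f = All.all? (sends? f)

  satisfies-update : ∀ f ps {x} v → x ∉ map proj₁ ps →
                     𝟙 (satisfies? (f [ x ]≔ v) ps) ≡ 𝟙 (satisfies? f ps)
  satisfies-update f []             v x∉ = refl
  satisfies-update f ((x′ , y) ∷ ps) {x} v x∉ = begin
    𝟙 (satisfies? (f [ x ]≔ v) ((x′ , y) ∷ ps))
      ≡⟨ 𝟙-× (sends? (f [ x ]≔ v) (x′ , y)) (satisfies? (f [ x ]≔ v) ps) ⟩
    𝟙 (lookup (f [ x ]≔ v) x′ Fin.≟ y) * 𝟙 (satisfies? (f [ x ]≔ v) ps)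
      ≡⟨ cong₂ _*_ (cong (λ z → 𝟙 (z Fin.≟ y)) (Vec.lookup∘update′ (λ eq → x∉ (here (sym eq))) f v))
           (satisfies-update f ps v (x∉ ∘ there)) ⟩
    𝟙 (sends? f (x′ , y)) * 𝟙 (satisfies? f ps)
      ≡⟨ 𝟙-× (sends? f (x′ , y)) (satisfies? f ps) ⟨
    𝟙 (satisfies? f ((x′ , y) ∷ ps)) ∎
    where open ≡-Reasoning

count-≟ : ∀ {n} (y : Fin n) → ∑ (allFin n) (λ x → 𝟙 (x Fin.≟ y)) ≡ 1
count-≟ {n} y = trans
  (∑-cong (allFin n) (λ x → 𝟙-cong (x Fin.≟ y) (x ∈? (y ∷ [])) here (λ { (here eq) → eq })))
  (count-∈ (allFin-enumerates n) ([] ∷ []) (_∈? (y ∷ [])))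

-- Distinct arguments make the prescriptions independent, each cutting down the functions by a
-- factor M. The power of M stands on the left so that no division or truncated exponent appears.
count-satisfying : ∀ {M n} (ps : List (Fin n × Fin M)) → Unique (map proj₁ ps) →
  ∑ (vecs (allFin M) n) (λ f → 𝟙 (satisfies? f ps)) * M ^ length ps ≡ M ^ n
count-satisfying {M} {n} [] [] = trans (*-identityʳ _)
  (trans (∑-vecs-1 (allFin M) n) (cong (_^ n) (length-allFin M)))
count-satisfying {M} {n} ((x , y) ∷ ps) u@(_ ∷ u′) = begin
  ∑ F (λ f → S f ((x , y) ∷ ps)) * (M * M ^ length ps)
    ≡⟨ *-assoc (∑ F (λ f → S f ((x , y) ∷ ps))) M _ ⟨
  ∑ F (λ f → S f ((x , y) ∷ ps)) * M * M ^ length ps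
    ≡⟨ cong (_* M ^ length ps) free ⟩
  ∑ F (λ f → S f ps) * M ^ length ps
    ≡⟨ count-satisfying ps u′ ⟩
  M ^ n ∎
  where
  open ≡-Reasoning
  F = vecs (allFin M) n
  S : Vec (Fin M) n → List (Fin n × Fin M) → ℕ
  S f ps = 𝟙 (satisfies? f ps)
  -- Overwriting the value at x in all M ways covers every function M times, and exactly one of the
  -- M values meets the prescription at x.
  free : ∑ F (λ f → S f ((x , y) ∷ ps)) * M ≡ ∑ F (λ f → S f ps)
  free = begin
    ∑ F (λ f → S f ((x , y) ∷ ps)) * M
      ≡⟨ *-comm _ M ⟩
    M * ∑ F (λ f → S f ((x , y) ∷ ps))
      ≡⟨ cong (_* ∑ F (λ f → S f ((x , y) ∷ ps))) (length-allFin M) ⟨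
    length (allFin M) * ∑ F (λ f → S f ((x , y) ∷ ps))
      ≡⟨ ∑-update (allFin M) x (λ f → S f ((x , y) ∷ ps)) ⟨
    ∑ F (λ f → ∑ (allFin M) (λ v → S (f [ x ]≔ v) ((x , y) ∷ ps)))
      ≡⟨ ∑-cong F (λ f → ∑-cong (allFin M) (λ v → begin
           S (f [ x ]≔ v) ((x , y) ∷ ps)
             ≡⟨ 𝟙-× (sends? (f [ x ]≔ v) (x , y)) (satisfies? (f [ x ]≔ v) ps) ⟩
           𝟙 (lookup (f [ x ]≔ v) x Fin.≟ y) * S (f [ x ]≔ v) ps
             ≡⟨ cong₂ _*_ (cong (λ z → 𝟙 (z Fin.≟ y)) (Vec.lookup∘update x f v))
                  (satisfies-update f ps v (Unique.Unique[x∷xs]⇒x∉xs u)) ⟩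
           𝟙 (v Fin.≟ y) * S f ps ∎)) ⟩
    ∑ F (λ f → ∑ (allFin M) (λ v → 𝟙 (v Fin.≟ y) * S f ps))
      ≡⟨ ∑-cong F (λ f → trans (∑-*ʳ (allFin M) _ (S f ps)) (cong (_* S f ps) (count-≟ y))) ⟩
    ∑ F (λ f → 1 * S f ps)
      ≡⟨ ∑-cong F (λ f → *-identityˡ (S f ps)) ⟩
    ∑ F (λ f → S f ps) ∎

-- Families of disjoint cycles and falling-factorial sums

values : ∀ {M n} → Vec (Fin M) n → Vec ℕ n
values = Vec.map (suc ∘ toℕ)

module _ {m : ℕ} .{{_ : NonZero m}} where

  private
    origin : Fin m
    origin = 0 mod m

  -- The prescriptions under which `b` becomes a cycle: containing given disjoint cycles is then a
  -- case of `count-satisfying`.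
  arrows : {A : Set} → Vec A m → List (A × A)
  arrows b = List.tabulate (λ j → lookup b j , lookup b (shift 1 j))

  allArrows : {A : Set} {s : ℕ} → Vec (Vec A m) s → List (A × A)
  allArrows []       = []
  allArrows (b ∷ bs) = arrows b ++ allArrows bs

  sources : {A : Set} {s : ℕ} (bs : Vec (Vec A m) s) → map proj₁ (allArrows bs) ≡ points bs
  sources []       = refl
  sources (b ∷ bs) = begin
    map proj₁ (arrows b ++ allArrows bs)               ≡⟨ List.map-++ proj₁ (arrows b) _ ⟩
    map proj₁ (arrows b) ++ map proj₁ (allArrows bs)   ≡⟨ cong₂ _++_
        (trans (List.map-tabulate _ proj₁) (tabulate-lookup b)) (sources bs) ⟩
    toList b ++ points bs                              ∎
    where open ≡-Reasoning

  length-allArrows : {A : Set} {s : ℕ} (bs : Vec (Vec A m) s) → length (allArrows bs) ≡ s * m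
  length-allArrows {s = s} bs = begin
    length (allArrows bs)               ≡⟨ List.length-map proj₁ (allArrows bs) ⟨
    length (map proj₁ (allArrows bs))   ≡⟨ cong length (sources bs) ⟩
    length (points bs)                  ≡⟨ length-points bs ⟩
    s * m                               ∎
    where open ≡-Reasoning

  module _ {N : ℕ} (f : Vec (Fin N) N) where

    private
      π : Vec ℕ N
      π = values f

    isCycle⇒arrows : ∀ {b : Vec (Fin N) m} → IsCycle π b → All (λ (x , y) → lookup f x ≡ y) (arrows b)
    isCycle⇒arrows {b} p = All.tabulate⁺ λ j → Fin.toℕ-injective (suc-injective
      (trans (sym (Vec.lookup-map (lookup b j) _ f)) (IsCycle.cyclic p j)))

    arrows⇒isCycle : ∀ {b : Vec (Fin N) m} → Unique (toList b) →
                     All (λ (x , y) → lookup f x ≡ y) (arrows b) → IsCycle π b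
    arrows⇒isCycle {b} u a = record
      { distinct = toList-unique⁻ u
      ; cyclic   = λ j → trans (Vec.lookup-map (lookup b j) _ f) (cong (suc ∘ toℕ) (All.tabulate⁻ a j))
      }

    -- Inequivalence suits the choice of cycles one after another, disjointness suits the count over
    -- functions; for cycles the two agree by `meeting-cycles`.
    CycleFamily : ∀ {s} → Vec (Vec (Fin N) m) s → Set
    CycleFamily bs = All (IsCycle π) (toList bs) × AllPairs (λ b c → ¬ b ≈rot c) (toList bs)

    cycleFamily? : ∀ {s} → Decidable (CycleFamily {s})
    cycleFamily? bs = All.all? (isCycle? π) (toList bs)
      ×-dec AllPairs.allPairs? (λ b c → ¬? (b ≈rot? c)) (toList bs)

    cycleFamily⁺ : ∀ {s} (bs : Vec (Vec (Fin N) m) s) → Unique (points bs) →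
                   All (λ (x , y) → lookup f x ≡ y) (allArrows bs) → CycleFamily bs
    cycleFamily⁺ []       u a = [] , []
    cycleFamily⁺ (b ∷ bs) u a =
      let (ub , ubs , d) = unique-++⁻ (toList b) u
          (ab , abs)     = All.++⁻ (arrows b) a
          (cs , ps)      = cycleFamily⁺ bs ubs abs
      in arrows⇒isCycle ub ab ∷ cs ,
         -- Rotations of each other share their entries, so a single common entry contradicts
         -- disjointness; the position `origin` exists because m is nonzero.
         All.tabulate (λ {c} c∈ (r , eq) → d (∈-toList⁺ b (shift r origin) ,
           ∈-points⁺ bs (Any.map (λ { refl → subst (_∈ toList c) (eq origin) (∈-toList⁺ c origin) }) c∈))) ∷ ps

    cycleFamily⁻ : ∀ {s} (bs : Vec (Vec (Fin N) m) s) → CycleFamily bs →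
                   Unique (points bs) × All (λ (x , y) → lookup f x ≡ y) (allArrows bs)
    cycleFamily⁻ []       _                = [] , []
    cycleFamily⁻ (b ∷ bs) (c ∷ cs , p ∷ ps) =
      let (u , a) = cycleFamily⁻ bs (cs , ps) in
      Unique.++⁺ (toList-unique⁺ (IsCycle.distinct c)) u disjoint ,
      All.++⁺ (isCycle⇒arrows c) a
      where
      disjoint : Disjoint (toList b) (points bs)
      disjoint (x∈b , x∈bs) =
        let any         = ∈-points⁻ bs x∈bs
            (i , eq)    = ∈-toList⁻ b x∈b
            (j , eq′)   = ∈-toList⁻ (Any.lookup any) (proj₂ (All.lookupAny cs any))
            (¬rot , _)  = All.lookupAny p any
            (isc , _)   = All.lookupAny cs any
        in ¬rot (meeting-cycles c isc (trans eq (sym eq′)))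

    𝟙-cycleFamily : ∀ {s} (bs : Vec (Vec (Fin N) m) s) →
      𝟙 (cycleFamily? bs) ≡ 𝟙 (unique? (points bs)) * 𝟙 (satisfies? f (allArrows bs))
    𝟙-cycleFamily bs = trans
      (𝟙-cong (cycleFamily? bs) (unique? (points bs) ×-dec satisfies? f (allArrows bs))
        (cycleFamily⁻ bs) (λ (u , a) → cycleFamily⁺ bs u a))
      (𝟙-× (unique? (points bs)) (satisfies? f (allArrows bs)))

    isNewCycle? : ∀ {s} (bs : Vec (Vec (Fin N) m) s) →
                  Decidable (λ b → IsCycle π b × ¬ Any (_≈rot b) (toList bs))
    isNewCycle? bs b = isCycle? π b ×-dec ¬? (b ∈rot? toList bs)

    𝟙-cycleFamily-∷ : ∀ {s} b (bs : Vec (Vec (Fin N) m) s) →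
      𝟙 (cycleFamily? (b ∷ bs)) ≡ 𝟙 (cycleFamily? bs) * 𝟙 (isNewCycle? bs b)
    𝟙-cycleFamily-∷ b bs = trans
      (𝟙-cong (cycleFamily? (b ∷ bs)) (cycleFamily? bs ×-dec isNewCycle? bs b)
        (λ { (c ∷ cs , p ∷ ps) → (cs , ps) , c ,
             λ any → All.All¬⇒¬Any p (Any.map (λ {d} → ≈rot-sym d b) any) })
        (λ { ((cs , ps) , c , new) →
             c ∷ cs , All.¬Any⇒All¬ (toList bs) (new ∘ Any.map (λ {d} → ≈rot-sym b d)) ∷ ps }))
      (𝟙-× (cycleFamily? bs) (isNewCycle? bs b))

    -- The s members of the family are inequivalent, so their rotations make up exactly `s * m` of
    -- the pointed cycles.
    count-new-cycles : ∀ {s} (bs : Vec (Vec (Fin N) m) s) → CycleFamily bs →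
                       ∑ blocks (𝟙 ∘ isNewCycle? bs) ≡ #cycles {m} π ∸ s * m
    count-new-cycles {s} bs (cs , ps) = sym (begin
      #cycles {m} π ∸ s * m    ≡⟨ cong₂ _∸_ total (sym old≡s*m) ⟩
      (old + new) ∸ old        ≡⟨ m+n∸m≡n old new ⟩
      new                      ∎)
      where
      open ≡-Reasoning
      old = ∑ blocks (λ b → 𝟙 (b ∈rot? toList bs))
      new = ∑ blocks (𝟙 ∘ isNewCycle? bs)
      old≡s*m : old ≡ s * m
      old≡s*m = trans (count-∈rot (All.map IsCycle.distinct cs) ps) (cong (_* m) (Vec.length-toList bs))
      split : ∀ {b} → IsCycle π b →
              Any (_≈rot b) (toList bs) ⊎ (IsCycle π b × ¬ Any (_≈rot b) (toList bs))
      split {b} c with b ∈rot? toList bs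
      ... | yes any = inj₁ any
      ... | no ¬any = inj₂ (c , ¬any)
      total : #cycles {m} π ≡ old + new
      total = trans
        (∑-cong blocks (λ b → 𝟙-⊎ (b ∈rot? toList bs) (isNewCycle? bs b) (isCycle? π b)
          (λ any → let (c , r) = All.lookupAny cs any in rotation-isCycle c r)
          proj₁ split (λ (any , _ , ¬any) → ¬any any)))
        (∑-+ blocks _ _)

    -- Successive choice: after s members, k - s cycles with m starting points each remain.
    count-cycleFamilies : ∀ {k} → #cycles {m} π ≡ k * m → ∀ s →
      ∑ (vecs blocks s) (𝟙 ∘ cycleFamily?) ≡ m ^ s * k ↓ s
    count-cycleFamilies {k} eq zero    = refl
    count-cycleFamilies {k} eq (suc s) = begin
      ∑ (vecs blocks (suc s)) (𝟙 ∘ cycleFamily?)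
        ≡⟨ ∑-vecs-suc blocks s _ ⟩
      ∑ blocks (λ b → ∑ (vecs blocks s) (λ bs → 𝟙 (cycleFamily? (b ∷ bs))))
        ≡⟨ ∑-swap blocks (vecs blocks s) _ ⟩
      ∑ (vecs blocks s) (λ bs → ∑ blocks (λ b → 𝟙 (cycleFamily? (b ∷ bs))))
        ≡⟨ ∑-cong (vecs blocks s) (λ bs → trans
             (∑-cong blocks (λ b → 𝟙-cycleFamily-∷ b bs))
             (∑-*ˡ blocks (𝟙 (cycleFamily? bs)) _)) ⟩
      ∑ (vecs blocks s) (λ bs → 𝟙 (cycleFamily? bs) * ∑ blocks (𝟙 ∘ isNewCycle? bs))
        ≡⟨ ∑-cong (vecs blocks s) (λ bs → 𝟙-guard (cycleFamily? bs) (λ fam →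
             trans (count-new-cycles bs fam) remaining)) ⟩
      ∑ (vecs blocks s) (λ bs → 𝟙 (cycleFamily? bs) * ((k ∸ s) * m))
        ≡⟨ ∑-*ʳ (vecs blocks s) _ _ ⟩
      ∑ (vecs blocks s) (𝟙 ∘ cycleFamily?) * ((k ∸ s) * m)
        ≡⟨ cong (_* ((k ∸ s) * m)) (count-cycleFamilies eq s) ⟩
      m ^ s * k ↓ s * ((k ∸ s) * m)
        ≡⟨ solve 4 (λ a b c d → (a :* b) :* (c :* d) := (d :* a) :* (c :* b)) refl (m ^ s) (k ↓ s) (k ∸ s) m ⟩
      m ^ suc s * k ↓ suc s ∎
      where
      open ≡-Reasoning
      open +-*-Solver
      -- For s beyond k both sides are 0, so the truncated subtractions agree.
      remaining : #cycles {m} π ∸ s * m ≡ (k ∸ s) * m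
      remaining = trans (cong (_∸ s * m) eq) (sym (*-distribʳ-∸ m k s))

  -- For a family with distinct points, the `s * m` arrows prescribe as many values of f. The factor
  -- `N ^ (s * m)` keeps the identity meaningful for `s * m` beyond N, where the right side
  -- vanishes; that case yields the bound on the number of cycles and the vanishing of the terms
  -- outside the range of summation.
  ∑-falling-cycles : ∀ N s (k : Vec (Fin N) N → ℕ) → (∀ f → #cycles {m} (values f) ≡ k f * m) →
    ∑ (vecs (allFin N) N) (λ f → m ^ s * k f ↓ s) * N ^ (s * m) ≡ N ↓ (s * m) * N ^ N
  ∑-falling-cycles N s k eq = begin
    ∑ F (λ f → m ^ s * k f ↓ s) * N ^ (s * m)
      ≡⟨ cong (_* N ^ (s * m)) (∑-cong F (λ f → sym (count-cycleFamilies f (eq f) s))) ⟩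
    ∑ F (λ f → ∑ T (λ bs → 𝟙 (cycleFamily? f bs))) * N ^ (s * m)
      ≡⟨ cong (_* N ^ (s * m)) (∑-swap F T _) ⟩
    ∑ T (λ bs → ∑ F (λ f → 𝟙 (cycleFamily? f bs))) * N ^ (s * m)
      ≡⟨ cong (_* N ^ (s * m)) (∑-cong T (λ bs → trans
           (∑-cong F (λ f → 𝟙-cycleFamily f bs)) (∑-*ˡ F (U bs) _))) ⟩
    ∑ T (λ bs → U bs * ∑ F (λ f → 𝟙 (satisfies? f (allArrows bs)))) * N ^ (s * m)
      ≡⟨ ∑-*ʳ T _ _ ⟨
    ∑ T (λ bs → U bs * ∑ F (λ f → 𝟙 (satisfies? f (allArrows bs))) * N ^ (s * m))
      ≡⟨ ∑-cong T (λ bs → trans (*-assoc (U bs) _ _) (𝟙-guard (unique? (points bs)) (λ u → extensions bs u))) ⟩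
    ∑ T (λ bs → U bs * N ^ N)
      ≡⟨ ∑-*ʳ T U _ ⟩
    ∑ T U * N ^ N
      ≡⟨ cong (_* N ^ N) (count-disjoint-blocks N m s) ⟩
    N ↓ (s * m) * N ^ N ∎
    where
    open ≡-Reasoning
    F = vecs (allFin N) N
    T = vecs (blocks {m} {n = N}) s
    U : Vec (Vec (Fin N) m) s → ℕ
    U bs = 𝟙 (unique? (points bs))
    extensions : ∀ bs → Unique (points bs) →
                 ∑ F (λ f → 𝟙 (satisfies? f (allArrows bs))) * N ^ (s * m) ≡ N ^ N
    extensions bs u = trans
      (cong (λ l → ∑ F (λ f → 𝟙 (satisfies? f (allArrows bs))) * N ^ l) (sym (length-allArrows bs)))
      (count-satisfying (allArrows bs) (subst Unique (sym (sources bs)) u))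

-- Falling factorials, alternating sums and binomial inversion

n<k⇒n↓k≡0 : ∀ {n k} → n < k → n ↓ k ≡ 0
n<k⇒n↓k≡0 {n} {suc k} (s≤s n≤k) = cong (_* n ↓ k) (m≤n⇒m∸n≡0 n≤k)

k≤n⇒n↓k>0 : ∀ {n} k → k ≤ n → 0 < n ↓ k
k≤n⇒n↓k>0         zero    k≤n = s≤s z≤n
k≤n⇒n↓k>0 {n} (suc k) k<n = *-mono-≤ (m<n⇒0<n∸m k<n) (k≤n⇒n↓k>0 k (<⇒≤ k<n))

n↓k*[n∸k]!≡n! : ∀ {n} k → k ≤ n → n ↓ k * (n ∸ k) ! ≡ n !
n↓k*[n∸k]!≡n!     zero    k≤n = +-identityʳ _
n↓k*[n∸k]!≡n! {n} (suc k) k<n = begin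
  (n ∸ k) * n ↓ k * (n ∸ suc k) !        ≡⟨ cong (_* (n ∸ suc k) !) (*-comm (n ∸ k) (n ↓ k)) ⟩
  n ↓ k * (n ∸ k) * (n ∸ suc k) !        ≡⟨ *-assoc (n ↓ k) _ _ ⟩
  n ↓ k * ((n ∸ k) * (n ∸ suc k) !)      ≡⟨ cong (λ x → n ↓ k * (x * (n ∸ suc k) !)) step ⟩
  n ↓ k * (suc (n ∸ suc k)) !            ≡⟨ cong (λ x → n ↓ k * x !) step ⟨
  n ↓ k * (n ∸ k) !                      ≡⟨ n↓k*[n∸k]!≡n! k (<⇒≤ k<n) ⟩
  n !                                    ∎
  where
  open ≡-Reasoning
  step : n ∸ k ≡ suc (n ∸ suc k)
  step = +-∸-assoc 1 k<n

nCk*k!≡n↓k : ∀ n k → n C k * k ! ≡ n ↓ k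
nCk*k!≡n↓k n k with k ≤? n
... | no k≰n  = trans (cong (_* k !) (k>n⇒nCk≡0 (≰⇒> k≰n))) (sym (n<k⇒n↓k≡0 (≰⇒> k≰n)))
... | yes k≤n = begin
  n C k * k !          ≡⟨ cong (_* k !) (trans (nCk≡nPk/k! k≤n) (/-congˡ {o = k !} (nPk≡n↓k))) ⟩
  n ↓ k DivMod./ k ! * k !    ≡⟨ m/n*n≡m (k!∣nP′k k≤n) ⟩
  n ↓ k                ∎
  where
  open ≡-Reasoning
  instance _ = k !≢0
  nPk≡n↓k : n Combinatorics.P k ≡ n ↓ k
  nPk≡n↓k with k ≤ᵇ n | ≤⇒≤ᵇ k≤n
  ... | true | _ = refl

sign : ℕ → ℤ
sign ℓ = ℤ.-1ℤ ℤ.^ ℓ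

sumℤ : List ℤ → ℤ
sumℤ = List.foldr ℤ._+_ ℤ.0ℤ

alternating : List ℕ → (ℕ → ℕ) → ℤ
alternating xs y = sumℤ (map (λ ℓ → sign ℓ ℤ.* ℤ.+ y ℓ) xs)

alternating-cong : ∀ xs {y z : ℕ → ℕ} → (∀ ℓ → y ℓ ≡ z ℓ) → alternating xs y ≡ alternating xs z
alternating-cong []       eq = refl
alternating-cong (ℓ ∷ xs) eq = cong₂ (λ a b → sign ℓ ℤ.* ℤ.+ a ℤ.+ b) (eq ℓ) (alternating-cong xs eq)

alternating-0 : ∀ xs → alternating xs (λ _ → 0) ≡ ℤ.0ℤ
alternating-0 []       = refl
alternating-0 (ℓ ∷ xs) = cong₂ ℤ._+_ (ℤ.*-zeroʳ (sign ℓ)) (alternating-0 xs)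

alternating-+ : ∀ xs (y z : ℕ → ℕ) →
  alternating xs (λ ℓ → y ℓ + z ℓ) ≡ alternating xs y ℤ.+ alternating xs z
alternating-+ []       y z = refl
alternating-+ (ℓ ∷ xs) y z = trans
  (cong (λ a → sign ℓ ℤ.* (ℤ.+ y ℓ ℤ.+ ℤ.+ z ℓ) ℤ.+ a) (alternating-+ xs y z))
  (solve 5 (λ s a b c d → s :* (a :+ b) :+ (c :+ d) := (s :* a :+ c) :+ (s :* b :+ d)) refl
     (sign ℓ) (ℤ.+ y ℓ) (ℤ.+ z ℓ) (alternating xs y) (alternating xs z))
  where open ℤ-Solver

alternating-* : ∀ xs a (y : ℕ → ℕ) →
  alternating xs (λ ℓ → a * y ℓ) ≡ ℤ.+ a ℤ.* alternating xs y
alternating-* []       a y = sym (ℤ.*-zeroʳ (ℤ.+ a))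
alternating-* (ℓ ∷ xs) a y = trans
  (cong₂ (λ b c → sign ℓ ℤ.* b ℤ.+ c) (ℤ.pos-* a (y ℓ)) (alternating-* xs a y))
  (solve 4 (λ s a b c → s :* (a :* b) :+ a :* c := a :* (s :* b :+ c)) refl
     (sign ℓ) (ℤ.+ a) (ℤ.+ y ℓ) (alternating xs y))
  where open ℤ-Solver

alternating-∑ : ∀ {A : Set} xs (F : List A) (y : A → ℕ → ℕ) (g : A → ℕ) →
  (∀ {f} → f ∈ F → alternating xs (y f) ≡ ℤ.+ g f) →
  alternating xs (λ ℓ → ∑ F (λ f → y f ℓ)) ≡ ℤ.+ ∑ F g
alternating-∑ xs []      y g eq = alternating-0 xs
alternating-∑ xs (f ∷ F) y g eq = trans
  (alternating-+ xs (y f) _)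
  (cong₂ ℤ._+_ (eq (here refl)) (alternating-∑ xs F y g (eq ∘ there)))

alternating-∷ʳ : ∀ xs ℓ (y : ℕ → ℕ) →
  alternating (xs ∷ʳ ℓ) y ≡ alternating xs y ℤ.+ sign ℓ ℤ.* ℤ.+ y ℓ
alternating-∷ʳ []       ℓ y = ℤ.+-comm (sign ℓ ℤ.* ℤ.+ y ℓ) ℤ.0ℤ
alternating-∷ʳ (x ∷ xs) ℓ y = trans
  (cong (λ a → sign x ℤ.* ℤ.+ y x ℤ.+ a) (alternating-∷ʳ xs ℓ y))
  (sym (ℤ.+-assoc (sign x ℤ.* ℤ.+ y x) _ _))

alternating-upTo-suc : ∀ L (y : ℕ → ℕ) →
  alternating (upTo (suc L)) y ≡ alternating (upTo L) y ℤ.+ sign L ℤ.* ℤ.+ y L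
alternating-upTo-suc L y =
  trans (cong (λ xs → alternating xs y) (sym (List.upTo-∷ʳ L))) (alternating-∷ʳ (upTo L) L y)

-- By Pascal's rule each new term cancels the previous partial sum and leaves one entry of row d.
alternating-binomial : ∀ d L → alternating (upTo (suc L)) (suc d C_) ≡ sign L ℤ.* ℤ.+ (d C L)
alternating-binomial d zero    = refl
alternating-binomial d (suc L) = begin
  alternating (upTo (suc (suc L))) (suc d C_)
    ≡⟨ alternating-upTo-suc (suc L) (suc d C_) ⟩
  alternating (upTo (suc L)) (suc d C_) ℤ.+ sign (suc L) ℤ.* ℤ.+ (suc d C suc L)
    ≡⟨ cong₂ (λ a b → a ℤ.+ sign (suc L) ℤ.* ℤ.+ b) (alternating-binomial d L)
         (sym (nCk+nC[k+1]≡[n+1]C[k+1] d L)) ⟩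
  sign L ℤ.* ℤ.+ (d C L) ℤ.+ sign (suc L) ℤ.* (ℤ.+ (d C L) ℤ.+ ℤ.+ (d C suc L))
    ≡⟨ solve 3 (λ e x y → e :* x :+ (con ℤ.-1ℤ :* e) :* (x :+ y) := (con ℤ.-1ℤ :* e) :* y) refl
         (sign L) (ℤ.+ (d C L)) (ℤ.+ (d C suc L)) ⟩
  sign (suc L) ℤ.* ℤ.+ (d C suc L) ∎
  where
  open ≡-Reasoning
  open ℤ-Solver

alternating-0C : ∀ L → alternating (upTo (suc L)) (0 C_) ≡ ℤ.1ℤ
alternating-0C zero    = refl
alternating-0C (suc L) = begin
  alternating (upTo (suc (suc L))) (0 C_)
    ≡⟨ alternating-upTo-suc (suc L) (0 C_) ⟩
  alternating (upTo (suc L)) (0 C_) ℤ.+ sign (suc L) ℤ.* ℤ.0ℤ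
    ≡⟨ cong₂ ℤ._+_ (alternating-0C L) (ℤ.*-zeroʳ (sign (suc L))) ⟩
  ℤ.1ℤ ∎
  where open ≡-Reasoning

-- Binomial inversion for the indicator of c = k.
alternating-indicator : ∀ {c} k L → c ≤ L →
  alternating (upTo (suc L)) (λ ℓ → c C k * ((c ∸ k) C ℓ)) ≡ ℤ.+ 𝟙 (c ≟ k)
alternating-indicator {c} k L c≤L =
  trans (alternating-* (upTo (suc L)) (c C k) ((c ∸ k) C_)) (cases (<-cmp c k))
  where
  open ≡-Reasoning
  cases : Tri (c < k) (c ≡ k) (c > k) →
          ℤ.+ (c C k) ℤ.* alternating (upTo (suc L)) ((c ∸ k) C_) ≡ ℤ.+ 𝟙 (c ≟ k)
  cases (tri< c<k c≢k _) = begin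
    ℤ.+ (c C k) ℤ.* rest ≡⟨ cong (λ x → ℤ.+ x ℤ.* rest) (k>n⇒nCk≡0 c<k) ⟩
    ℤ.0ℤ                 ≡⟨ cong ℤ.+_ (𝟙-no (c ≟ k) c≢k) ⟨
    ℤ.+ 𝟙 (c ≟ k)        ∎
    where rest = alternating (upTo (suc L)) ((c ∸ k) C_)
  cases (tri≈ _ refl _) = begin
    ℤ.+ (c C c) ℤ.* alternating (upTo (suc L)) ((c ∸ c) C_)
      ≡⟨ cong₂ (λ x y → ℤ.+ x ℤ.* alternating (upTo (suc L)) (y C_)) (nCn≡1 c) (n∸n≡0 c) ⟩
    ℤ.1ℤ ℤ.* alternating (upTo (suc L)) (0 C_)
      ≡⟨ cong (ℤ.1ℤ ℤ.*_) (alternating-0C L) ⟩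
    ℤ.1ℤ
      ≡⟨ cong ℤ.+_ (𝟙-yes (c ≟ c) refl) ⟨
    ℤ.+ 𝟙 (c ≟ c) ∎
  cases (tri> _ c≢k k<c) = begin
    ℤ.+ (c C k) ℤ.* alternating (upTo (suc L)) ((c ∸ k) C_)
      ≡⟨ cong (λ x → ℤ.+ (c C k) ℤ.* alternating (upTo (suc L)) (x C_)) c∸k≡1+d ⟩
    ℤ.+ (c C k) ℤ.* alternating (upTo (suc L)) (suc d C_)
      ≡⟨ cong (ℤ.+ (c C k) ℤ.*_) (alternating-binomial d L) ⟩
    ℤ.+ (c C k) ℤ.* (sign L ℤ.* ℤ.+ (d C L))
      -- The sum covers the whole row, since `suc d`, which is `c ∸ k`, is at most L.
      ≡⟨ cong (λ x → ℤ.+ (c C k) ℤ.* (sign L ℤ.* ℤ.+ x))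
           (k>n⇒nCk≡0 (≤-trans (≤-reflexive (sym c∸k≡1+d)) (≤-trans (m∸n≤m c k) c≤L))) ⟩
    ℤ.+ (c C k) ℤ.* (sign L ℤ.* ℤ.0ℤ)
      ≡⟨ cong (ℤ.+ (c C k) ℤ.*_) (ℤ.*-zeroʳ (sign L)) ⟩
    ℤ.+ (c C k) ℤ.* ℤ.0ℤ
      ≡⟨ ℤ.*-zeroʳ (ℤ.+ (c C k)) ⟩
    ℤ.0ℤ
      ≡⟨ cong ℤ.+_ (𝟙-no (c ≟ k) c≢k) ⟨
    ℤ.+ 𝟙 (c ≟ k) ∎
    where
    d = pred (c ∸ k)
    c∸k≡1+d : c ∸ k ≡ suc d
    c∸k≡1+d = sym (suc-pred (c ∸ k) {{>-nonZero (m<n⇒0<n∸m k<c)}})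

-- From rational to integer sums

toℚᵘ-/ : ∀ i d → ℚ.toℚᵘ (i ℚ./ suc d) ℚᵘ.≃ ℚᵘ.mkℚᵘ i d
toℚᵘ-/ i d = ℚ.toℚᵘ-fromℚᵘ (ℚᵘ.mkℚᵘ i d)

/1-+ : ∀ i j → (i ℚ./ 1) ℚ.+ (j ℚ./ 1) ≡ (i ℤ.+ j) ℚ./ 1
/1-+ i j = ℚ.toℚᵘ-injective (begin-equality
  ℚ.toℚᵘ ((i ℚ./ 1) ℚ.+ (j ℚ./ 1))              ≃⟨ ℚ.toℚᵘ-homo-+ (i ℚ./ 1) (j ℚ./ 1) ⟩
  ℚ.toℚᵘ (i ℚ./ 1) ℚᵘ.+ ℚ.toℚᵘ (j ℚ./ 1)        ≃⟨ ℚᵘ.+-cong (toℚᵘ-/ i 0) (toℚᵘ-/ j 0) ⟩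
  ℚᵘ.mkℚᵘ i 0 ℚᵘ.+ ℚᵘ.mkℚᵘ j 0                  ≃⟨ ℚᵘ.*≡* (solve 2 (λ i j →
                                                     (i :* con ℤ.1ℤ :+ j :* con ℤ.1ℤ) :* con ℤ.1ℤ
                                                     := (i :+ j) :* con ℤ.1ℤ) refl i j) ⟩
  ℚᵘ.mkℚᵘ (i ℤ.+ j) 0                           ≃⟨ toℚᵘ-/ (i ℤ.+ j) 0 ⟨
  ℚ.toℚᵘ ((i ℤ.+ j) ℚ./ 1)                      ∎)
  where
  open ℚᵘ.≤-Reasoning
  open ℤ-Solver

-- Intended for `summand`, whose truncated exponents match the signed count only at the admissible
-- indices; at the rejected ones the count itself is 0.
sumℚ-filter : {P : ℕ → Set} (P? : Decidable P) (xs : List ℕ) (g : ℕ → ℚ) (h : ℕ → ℤ) →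
  (∀ ℓ → P ℓ → g ℓ ≡ h ℓ ℚ./ 1) → (∀ ℓ → ¬ P ℓ → h ℓ ≡ ℤ.0ℤ) →
  sumℚ (map g (filter P? xs)) ≡ sumℤ (map h xs) ℚ./ 1
sumℚ-filter P? []       g h accept reject = refl
sumℚ-filter P? (ℓ ∷ xs) g h accept reject with P? ℓ
... | yes p = trans (cong₂ ℚ._+_ (accept ℓ p) (sumℚ-filter P? xs g h accept reject))
                    (/1-+ (h ℓ) _)
... | no ¬p = trans (sumℚ-filter P? xs g h accept reject)
                    (cong (ℚ._/ 1) (sym (trans (cong (ℤ._+ sumℤ (map h xs)) (reject ℓ ¬p))
                                               (ℤ.+-identityˡ (sumℤ (map h xs))))))

-- The left side has the shape of a `summand`. Unnormalised rationals multiply componentwise, so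
-- clearing denominators leaves the single integer equation of the hypothesis.
product-of-fractions : ∀ a b c d x p q .{{_ : NonZero p}} .{{_ : NonZero q}} →
  a ℤ.* b ℤ.* c ℤ.* d ≡ x ℤ.* ℤ.+ (p * q) →
  (a ℚ./ 1) ℚ.* (b ℚ./ p) ℚ.* (c ℚ./ q) ℚ.* (d ℚ./ 1) ≡ x ℚ./ 1
product-of-fractions a b c d x (suc p) (suc q) eq = ℚ.toℚᵘ-injective (begin-equality
  ℚ.toℚᵘ (A ℚ.* B ℚ.* C ℚ.* D)
    ≃⟨ ℚ.toℚᵘ-homo-* (A ℚ.* B ℚ.* C) D ⟩
  ℚ.toℚᵘ (A ℚ.* B ℚ.* C) ℚᵘ.* ℚ.toℚᵘ D
    ≃⟨ ℚᵘ.*-cong (ℚ.toℚᵘ-homo-* (A ℚ.* B) C) (toℚᵘ-/ d 0) ⟩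
  ℚ.toℚᵘ (A ℚ.* B) ℚᵘ.* ℚ.toℚᵘ C ℚᵘ.* ℚᵘ.mkℚᵘ d 0
    ≃⟨ ℚᵘ.*-congʳ (ℚᵘ.*-cong (ℚ.toℚᵘ-homo-* A B) (toℚᵘ-/ c q)) ⟩
  ℚ.toℚᵘ A ℚᵘ.* ℚ.toℚᵘ B ℚᵘ.* ℚᵘ.mkℚᵘ c q ℚᵘ.* ℚᵘ.mkℚᵘ d 0
    ≃⟨ ℚᵘ.*-congʳ (ℚᵘ.*-congʳ (ℚᵘ.*-cong (toℚᵘ-/ a 0) (toℚᵘ-/ b p))) ⟩
  ℚᵘ.mkℚᵘ a 0 ℚᵘ.* ℚᵘ.mkℚᵘ b p ℚᵘ.* ℚᵘ.mkℚᵘ c q ℚᵘ.* ℚᵘ.mkℚᵘ d 0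
    ≃⟨ ℚᵘ.*≡* (trans (ℤ.*-identityʳ _) (trans eq (cong (λ y → x ℤ.* ℤ.+ y) denominator))) ⟩
  ℚᵘ.mkℚᵘ x 0
    ≃⟨ toℚᵘ-/ x 0 ⟨
  ℚ.toℚᵘ (x ℚ./ 1) ∎)
  where
  open ℚᵘ.≤-Reasoning
  A = a ℚ./ 1
  B = b ℚ./ suc p
  C = c ℚ./ suc q
  D = d ℚ./ 1
  denominator : suc p * suc q ≡ 1 * suc p * suc q * 1
  denominator = sym (trans (*-identityʳ _) (cong (_* suc q) (*-identityˡ (suc p))))

^-distribʳ-* : ∀ s m n → (m * n) ^ s ≡ m ^ s * n ^ s
^-distribʳ-* zero    m n = refl
^-distribʳ-* (suc s) m n = trans (cong (m * n *_) (^-distribʳ-* s m n)) ([m*n]*[o*p]≡[m*o]*[n*p] m n (m ^ s) (n ^ s))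

product-factorials : ∀ s m e → product (map _! (replicate s m ∷ʳ e)) ≡ (m !) ^ s * e !
product-factorials zero    m e = *-comm (e !) 1
product-factorials (suc s) m e = trans (cong (m ! *_) (product-factorials s m e)) (sym (*-assoc (m !) _ _))

-- Counting functions with k cycles

module _ {m : ℕ} .{{_ : NonZero m}} (N : ℕ) where

  private
    n≤n*m : ∀ n → n ≤ n * m
    n≤n*m n = m≤m*n n m

    functions : List (Vec (Fin N) N)
    functions = vecs (allFin N) N

  cycle-number : Vec (Fin N) N → ℕ
  cycle-number f = proj₁ (cycles-countable {m} (values f))

  #cycles≡cycle-number : ∀ f → #cycles {m} (values f) ≡ cycle-number f * m
  #cycles≡cycle-number f = #cycles-exact (values f) (proj₂ (cycles-countable {m} (values f)))

  -- A function with more than N cycles would make the sum of the (N + 1)-st falling factorials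
  -- positive, whereas that sum vanishes because (N + 1)m distinct points do not fit into N.
  cycle-number≤N : .{{_ : NonZero N}} → ∀ {f} → f ∈ functions → cycle-number f ≤ N
  cycle-number≤N {f} f∈ = ≮⇒≥ λ N<c → <-irrefl (sym vanishes) (≤-trans
    (*-mono-≤ (*-mono-≤ (m^n>0 m (suc N)) (k≤n⇒n↓k>0 (suc N) N<c))
              (m^n>0 N (suc N * m)))
    (*-monoˡ-≤ (N ^ (suc N * m)) (term≤∑ (λ f → m ^ suc N * cycle-number f ↓ suc N) f∈)))
    where
    vanishes : ∑ functions (λ f → m ^ suc N * cycle-number f ↓ suc N) * N ^ (suc N * m) ≡ 0
    vanishes = trans (∑-falling-cycles N (suc N) cycle-number #cycles≡cycle-number)
      (cong (_* N ^ N) (n<k⇒n↓k≡0 (n≤n*m (suc N))))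

  module _ .{{_ : NonZero N}} (k : ℕ) where

    -- The number of triples (f, A, B) with A, B disjoint sets of k and ℓ m-cycles of f.
    marked : ℕ → ℕ
    marked ℓ = ∑ functions (λ f → cycle-number f C k * (cycle-number f ∸ k) C ℓ)

    -- Ordering A and B takes k! and ℓ! ways and pointing the cycles takes m^(k + ℓ) ways; the
    -- result is an ordered tuple of k + ℓ inequivalent pointed cycles.
    marked-falling : ∀ ℓ → marked ℓ * (k ! * ℓ !) * m ^ (k + ℓ)
                           ≡ ∑ functions (λ f → m ^ (k + ℓ) * cycle-number f ↓ (k + ℓ))
    marked-falling ℓ = begin
      marked ℓ * (k ! * ℓ !) * m ^ (k + ℓ)
        ≡⟨ cong (_* m ^ (k + ℓ)) (∑-*ʳ functions _ (k ! * ℓ !)) ⟨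
      ∑ functions (λ f → cycle-number f C k * (cycle-number f ∸ k) C ℓ * (k ! * ℓ !)) * m ^ (k + ℓ)
        ≡⟨ ∑-*ʳ functions _ (m ^ (k + ℓ)) ⟨
      ∑ functions (λ f → cycle-number f C k * (cycle-number f ∸ k) C ℓ * (k ! * ℓ !) * m ^ (k + ℓ))
        ≡⟨ ∑-cong functions (λ f → trans (*-comm _ (m ^ (k + ℓ)))
             (cong (m ^ (k + ℓ) *_) (choices (cycle-number f)))) ⟩
      ∑ functions (λ f → m ^ (k + ℓ) * cycle-number f ↓ (k + ℓ)) ∎
      where
      open ≡-Reasoning
      choices : ∀ c → c C k * (c ∸ k) C ℓ * (k ! * ℓ !) ≡ c ↓ (k + ℓ)
      choices c = begin
        c C k * (c ∸ k) C ℓ * (k ! * ℓ !)     ≡⟨ [m*n]*[o*p]≡[m*o]*[n*p] (c C k) _ (k !) (ℓ !) ⟩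
        (c C k * k !) * ((c ∸ k) C ℓ * ℓ !)   ≡⟨ cong₂ _*_ (nCk*k!≡n↓k c k) (nCk*k!≡n↓k (c ∸ k) ℓ) ⟩
        c ↓ k * (c ∸ k) ↓ ℓ                   ≡⟨ *-comm (c ↓ k) _ ⟩
        (c ∸ k) ↓ ℓ * c ↓ k                   ≡⟨ ↓-+ c ℓ k ⟨
        c ↓ (ℓ + k)                           ≡⟨ cong (c ↓_) (+-comm ℓ k) ⟩
        c ↓ (k + ℓ)                           ∎

    marked-total : ∀ ℓ → marked ℓ * (k ! * ℓ !) * m ^ (k + ℓ) * N ^ ((k + ℓ) * m)
                         ≡ N ↓ ((k + ℓ) * m) * N ^ N
    marked-total ℓ = trans (cong (_* N ^ ((k + ℓ) * m)) (marked-falling ℓ))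
      (∑-falling-cycles N (k + ℓ) cycle-number #cycles≡cycle-number)

    marked-formula : ∀ ℓ → (k + ℓ) * m ≤ N →
      marked ℓ * (k ! * ℓ !) * m ^ (k + ℓ) ≡ N ↓ ((k + ℓ) * m) * N ^ (N ∸ (k + ℓ) * m)
    marked-formula ℓ t≤N = *-cancelʳ-≡ _ _ (N ^ t) {{m^n≢0 N t}} (begin
      marked ℓ * (k ! * ℓ !) * m ^ (k + ℓ) * N ^ t   ≡⟨ marked-total ℓ ⟩
      N ↓ t * N ^ N                                   ≡⟨ cong (λ x → N ↓ t * N ^ x) (m∸n+n≡m t≤N) ⟨
      N ↓ t * N ^ (N ∸ t + t)                         ≡⟨ cong (N ↓ t *_) (^-distribˡ-+-* N (N ∸ t) t) ⟩
      N ↓ t * (N ^ (N ∸ t) * N ^ t)                   ≡⟨ *-assoc (N ↓ t) _ _ ⟨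
      N ↓ t * N ^ (N ∸ t) * N ^ t                     ∎)
      where
      open ≡-Reasoning
      t = (k + ℓ) * m

    marked-vanishes : ∀ ℓ → ¬ (k + ℓ) * m ≤ N → marked ℓ ≡ 0
    marked-vanishes ℓ t≰N = m*n≡0⇒m≡0 (marked ℓ) (k ! * ℓ !) {{m*n≢0 (k !) (ℓ !) {{k !≢0}} {{ℓ !≢0}}}}
      (m*n≡0⇒m≡0 _ (m ^ (k + ℓ)) {{m^n≢0 m (k + ℓ)}}
      (m*n≡0⇒m≡0 _ (N ^ ((k + ℓ) * m)) {{m^n≢0 N ((k + ℓ) * m)}}
      (trans (marked-total ℓ) (cong (_* N ^ N) (n<k⇒n↓k≡0 (≰⇒> t≰N))))))

    -- The m^s pointings in `marked-formula` combine with ((m - 1)!)^s to the (m!)^s of the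
    -- multinomial denominator.
    summand≡marked : ∀ ℓ → (k + ℓ) * m ≤ N →
                     summand (suc N) m k ℓ ≡ (sign ℓ ℤ.* ℤ.+ marked ℓ) ℚ./ 1
    summand≡marked ℓ t≤N = product-of-fractions (sign ℓ) (ℤ.+ A) (ℤ.+ (N !)) (ℤ.+ (N ^ e))
      (sign ℓ ℤ.* ℤ.+ marked ℓ) (k ! * ℓ !) D {{m*n≢0 (k !) (ℓ !) {{k !≢0}} {{ℓ !≢0}}}}
      {{ListAction.product≢0 (All.map⁺ (All.universal _!≢0 (replicate s m ∷ʳ e)))}} (begin
        sign ℓ ℤ.* ℤ.+ A ℤ.* ℤ.+ (N !) ℤ.* ℤ.+ (N ^ e)
          ≡⟨ ℤS.solve 4 (λ a b c d → a ℤS.:* b ℤS.:* c ℤS.:* d ℤS.:= a ℤS.:* (b ℤS.:* c ℤS.:* d)) refl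
               (sign ℓ) (ℤ.+ A) (ℤ.+ (N !)) (ℤ.+ (N ^ e)) ⟩
        sign ℓ ℤ.* (ℤ.+ A ℤ.* ℤ.+ (N !) ℤ.* ℤ.+ (N ^ e))
          ≡⟨ cong (sign ℓ ℤ.*_) (trans (cong (ℤ._* ℤ.+ (N ^ e)) (sym (ℤ.pos-* A (N !)))) (sym (ℤ.pos-* (A * N !) (N ^ e)))) ⟩
        sign ℓ ℤ.* ℤ.+ (A * N ! * N ^ e)
          ≡⟨ cong (λ x → sign ℓ ℤ.* ℤ.+ x) natural ⟩
        sign ℓ ℤ.* ℤ.+ (marked ℓ * (k ! * ℓ ! * D))
          ≡⟨ cong (sign ℓ ℤ.*_) (ℤ.pos-* (marked ℓ) (k ! * ℓ ! * D)) ⟩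
        sign ℓ ℤ.* (ℤ.+ marked ℓ ℤ.* ℤ.+ (k ! * ℓ ! * D))
          ≡⟨ ℤ.*-assoc (sign ℓ) (ℤ.+ marked ℓ) _ ⟨
        sign ℓ ℤ.* ℤ.+ marked ℓ ℤ.* ℤ.+ (k ! * ℓ ! * D) ∎)
      where
      open ≡-Reasoning
      module ℤS = ℤ-Solver
      module ℕS = +-*-Solver
      s = k + ℓ
      t = s * m
      e = suc N ∸ t ∸ 1
      A = ((m ∸ 1) !) ^ s
      D = product (map _! (replicate s m ∷ʳ e))
      e≡N∸t : e ≡ N ∸ t
      e≡N∸t = trans (∸-+-assoc (suc N) t 1) (cong (suc N ∸_) (+-comm t 1))
      m!≡m*[m∸1]! : ∀ m .{{_ : NonZero m}} → m ! ≡ m * (m ∸ 1) !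
      m!≡m*[m∸1]! (suc m) = refl
      N!≡ : N ! ≡ N ↓ t * e !
      N!≡ = sym (trans (cong (λ x → N ↓ t * x !) e≡N∸t) (n↓k*[n∸k]!≡n! t t≤N))
      [m!]^s≡ : (m !) ^ s ≡ m ^ s * A
      [m!]^s≡ = trans (cong (_^ s) (m!≡m*[m∸1]! m)) (^-distribʳ-* s m ((m ∸ 1) !))
      natural : A * N ! * N ^ e ≡ marked ℓ * (k ! * ℓ ! * D)
      natural = begin
        A * N ! * N ^ e
          ≡⟨ cong (λ x → A * x * N ^ e) N!≡ ⟩
        A * (N ↓ t * e !) * N ^ e
          ≡⟨ ℕS.solve 4 (λ a b c d → a ℕS.:* (b ℕS.:* c) ℕS.:* d ℕS.:= (b ℕS.:* d) ℕS.:* (a ℕS.:* c)) refl A (N ↓ t) (e !) (N ^ e) ⟩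
        N ↓ t * N ^ e * (A * e !)
          ≡⟨ cong (λ x → N ↓ t * N ^ x * (A * e !)) e≡N∸t ⟩
        N ↓ t * N ^ (N ∸ t) * (A * e !)
          ≡⟨ cong (_* (A * e !)) (marked-formula ℓ t≤N) ⟨
        marked ℓ * (k ! * ℓ !) * m ^ s * (A * e !)
          ≡⟨ ℕS.solve 5 (λ a b c d f → a ℕS.:* b ℕS.:* c ℕS.:* (d ℕS.:* f) ℕS.:= a ℕS.:* (b ℕS.:* (c ℕS.:* d ℕS.:* f))) refl (marked ℓ) (k ! * ℓ !) (m ^ s) A (e !) ⟩
        marked ℓ * (k ! * ℓ ! * (m ^ s * A * e !))
          ≡⟨ cong (λ x → marked ℓ * (k ! * ℓ ! * x)) (trans (cong (_* e !) (sym [m!]^s≡)) (sym (product-factorials s m e))) ⟩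
        marked ℓ * (k ! * ℓ ! * D) ∎

    -- The indicator of `cycle-number f ≡ k` is expanded and the sums are exchanged. By
    -- `cycle-number≤N` the range `upTo (suc N)` is long enough for the inversion.
    cycleSum-counts : (ℤ.+ ∑ functions (λ f → 𝟙 (cycle-number f ≟ k))) ℚ./ 1 ≡ cycleSum (suc N) m k
    cycleSum-counts = sym (trans
      (sumℚ-filter (λ ℓ → (k + ℓ) * m ≤? N) (upTo (suc N)) (summand (suc N) m k)
        (λ ℓ → sign ℓ ℤ.* ℤ.+ marked ℓ) summand≡marked
        (λ ℓ t≰N → trans (cong (λ x → sign ℓ ℤ.* ℤ.+ x) (marked-vanishes ℓ t≰N)) (ℤ.*-zeroʳ (sign ℓ))))
      (cong (ℚ._/ 1) (alternating-∑ (upTo (suc N)) functions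
        (λ f ℓ → cycle-number f C k * (cycle-number f ∸ k) C ℓ) (λ f → 𝟙 (cycle-number f ≟ k))
        (λ {f} f∈ → alternating-indicator k N (cycle-number≤N f∈)))))

-- Primality through counts, and the cycle lemma

module _ {A : Set} {P : A → Set} (P? : Decidable P) where

  count≡∑ : ∀ {n} (v : Vec A n) → Vec.count P? v ≡ ∑ (toList v) (𝟙 ∘ P?)
  count≡∑ []      = refl
  count≡∑ (x ∷ v) with does (P? x)
  ... | true  = cong suc (count≡∑ v)
  ... | false = count≡∑ v

  count-full : ∀ {n} (v : Vec A n) → n ≤ Vec.count P? v → VecAll.All P v
  count-full []      _ = VecAll.[]
  count-full (x ∷ v) n≤ with P? x
  ... | yes p = p VecAll.∷ count-full v (s≤s⁻¹ n≤)
  ... | no _  = contradiction (Vec.count≤n P? v) (<⇒≱ n≤)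

  count-none : ∀ {n} (v : Vec A n) → VecAll.All (¬_ ∘ P) v → Vec.count P? v ≡ 0
  count-none []      _ = refl
  count-none (x ∷ v) (¬p VecAll.∷ ¬ps) with P? x
  ... | yes p = contradiction p ¬p
  ... | no _  = count-none v ¬ps

-- In a sorted vector an entry above j is followed only by entries above j, so only earlier
-- positions can be counted.
sorted-count : ∀ {n} (v : Vec ℕ n) → AllPairs _≤_ (toList v) → ∀ i {j} → j < lookup v i →
               Vec.count (_≤? j) v ≤ toℕ i
sorted-count (x ∷ v) (x≤ ∷ _)  zero {j} j<x = ≤-reflexive (count-none (_≤? j) (x ∷ v)
  (VecAll.map (λ x≤y y≤j → <⇒≱ j<x (≤-trans x≤y y≤j)) (≤-refl VecAll.∷ VecAll.toList⁻ x≤)))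
sorted-count (x ∷ v) (_ ∷ ps) (suc i) {j} j<  with does (x ≤? j)
... | true  = s≤s (sorted-count v ps i j<)
... | false = m≤n⇒m≤1+n (sorted-count v ps i j<)

fromList-of-length : {A : Set} {n : ℕ} (xs : List A) → length xs ≡ n → ∃[ v ] toList {n = n} v ≡ xs
fromList-of-length xs refl = Vec.fromList xs , Vec.toList∘fromList xs

-- The rearrangement is obtained by sorting; by `sorted-count`, an entry above its bound would leave
-- too few small entries.
isPrimeParkingFunction⁺ : ∀ {N} .{{_ : NonZero N}} (π : Vec ℕ (suc N)) → VecAll.All (1 ≤_) π →
  (∀ j → 1 ≤ j → j ≤ N → j + 1 ≤ Vec.count (_≤? j) π) → IsPrimeParkingFunction π
isPrimeParkingFunction⁺ {N} π pos prime = record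
  { isParkingFunction = record
    { positive      = pos
    ; rearrangement = sorted
    ; permuted      = permuted
    ; increasing    = subst (Sorted ≤-totalOrder) (sym eq) (sort-↗ ≤-decTotalOrder (toList π))
    ; bounded       = λ i → ≮⇒≥ (unbounded i)
    }
  ; prime = prime
  }
  where
  sorted-Vec = fromList-of-length (sort ≤-decTotalOrder (toList π))
    (trans (Perm.↭-length (sort-↭ ≤-decTotalOrder (toList π))) (Vec.length-toList π))
  sorted : Vec ℕ (suc N)
  sorted = proj₁ sorted-Vec
  eq : toList sorted ≡ sort ≤-decTotalOrder (toList π)
  eq = proj₂ sorted-Vec
  permuted : toList sorted ↭ toList π
  permuted = subst (_↭ toList π) (sym eq) (sort-↭ ≤-decTotalOrder (toList π))
  few : ∀ i {j} → j < lookup sorted i → Vec.count (_≤? j) π ≤ toℕ i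
  few i {j} j< = subst (_≤ toℕ i)
    (trans (count≡∑ (_≤? j) sorted) (trans (∑-↭ _ permuted) (sym (count≡∑ (_≤? j) π))))
    (sorted-count sorted (Sorted⇒AllPairs ≤-totalOrder (subst (Sorted ≤-totalOrder) (sym eq) (sort-↗ ≤-decTotalOrder (toList π)))) i j<)
  unbounded : ∀ i → ¬ suc (toℕ i) < lookup sorted i
  unbounded i i< with suc (toℕ i) ≤? N
  ... | yes i<N = <⇒≱ (≤-trans (n≤1+n _) (≤-trans (≤-reflexive (+-comm 1 (suc (toℕ i)))) (prime (suc (toℕ i)) (s≤s z≤n) i<N)))
                       (few i i<)
  -- The last position is N + 1, beyond the range of j; here j = N is used, where the count already
  -- includes all N + 1 entries.
  ... | no  i≮N = <⇒≱ (≤-trans (≤-reflexive (+-comm 1 N)) (prime N (>-nonZero⁻¹ N) ≤-refl))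
                       (≤-trans (few i (≤-<-trans (≤-pred (≰⇒> i≮N)) (<-trans (n<1+n _) i<))) (s≤s⁻¹ (Fin.toℕ<n i)))

-- The cycle lemma: A is the partial-sum function of an N-periodic sequence with total N + 1 over a period.
module CycleLemma (A : ℕ → ℕ) (N : ℕ) (periodic : ∀ j → A (j + N) ≡ A j + suc N) where

  -- Without subtraction: during the N steps after t, `A j − j` stays strictly above its value at t.
  Good : ℕ → Set
  Good t = ∀ j → 1 ≤ j → j ≤ N → A t + (j + 1) ≤ A (t + j)

  -- The last minimum of A j − j on {0, …, M}.
  last-minimum : ∀ M → ∃[ t ] (t ≤ M × (∀ j → j ≤ M → A t + j ≤ A j + t)
                                      × (∀ j → t < j → j ≤ M → A t + j < A j + t))
  last-minimum zero    = 0 , z≤n , (λ { zero z≤n → ≤-refl }) , (λ { zero () _ ; (suc j) _ () })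
  last-minimum (suc M) with last-minimum M
  ... | t , t≤M , min , strictly with A (suc M) + t ≤? A t + suc M
  ...   | yes new = suc M , ≤-refl , below , λ j M<j j≤M → contradiction j≤M (<⇒≱ M<j)
    where
    below : ∀ j → j ≤ suc M → A (suc M) + j ≤ A j + suc M
    below j j≤ with m≤n⇒m<n∨m≡n j≤
    ... | inj₂ refl = ≤-refl
    ... | inj₁ (s≤s j≤M) = +-cancelʳ-≤ (t + A t) _ _ (begin
      A (suc M) + j + (t + A t)     ≡⟨ solve 4 (λ a b c d → a :+ b :+ (c :+ d) := a :+ c :+ (d :+ b)) refl (A (suc M)) j t (A t) ⟩
      A (suc M) + t + (A t + j)     ≤⟨ +-mono-≤ new (min j j≤M) ⟩
      A t + suc M + (A j + t)       ≡⟨ solve 4 (λ a b c d → a :+ b :+ (c :+ d) := c :+ b :+ (d :+ a)) refl (A t) (suc M) (A j) t ⟩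
      A j + suc M + (t + A t)       ∎)
      where
      open ≤-Reasoning
      open +-*-Solver
  ...   | no ¬new = t , m≤n⇒m≤1+n t≤M , below , strictly-below
    where
    below : ∀ j → j ≤ suc M → A t + j ≤ A j + t
    below j j≤ with m≤n⇒m<n∨m≡n j≤
    ... | inj₂ refl      = <⇒≤ (≰⇒> ¬new)
    ... | inj₁ (s≤s j≤M) = min j j≤M
    strictly-below : ∀ j → t < j → j ≤ suc M → A t + j < A j + t
    strictly-below j t<j j≤ with m≤n⇒m<n∨m≡n j≤
    ... | inj₂ refl      = ≰⇒> ¬new
    ... | inj₁ (s≤s j≤M) = strictly j t<j j≤M

  -- Over a period `A j − j` grows by one. After its last minimum it is strictly larger up to the
  -- end of the period, and beyond that the values from the beginning return, raised by one.
  good-exists : .{{_ : NonZero N}} → ∃[ t ] (t < N × Good t)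
  good-exists with last-minimum (pred N)
  ... | t , t≤M , min , strictly = t , t<N , good
    where
    open +-*-Solver
    open ≤-Reasoning
    t<N : t < N
    t<N = ≤-trans (s≤s t≤M) (≤-reflexive (suc-pred N))
    good : Good t
    good j 1≤j j≤N with t + j <? N
    ... | yes t+j<N = +-cancelʳ-≤ t _ _ (begin
      A t + (j + 1) + t   ≡⟨ solve 3 (λ a j t → a :+ (j :+ con 1) :+ t := con 1 :+ (a :+ (t :+ j))) refl (A t) j t ⟩
      suc (A t + (t + j)) ≤⟨ strictly (t + j) (m<m+n t 1≤j) (s≤s⁻¹ (≤-trans t+j<N (≤-reflexive (sym (suc-pred N))))) ⟩
      A (t + j) + t       ∎)
    ... | no t+j≮N = +-cancelʳ-≤ t _ _ (begin
      A t + (j + 1) + t   ≡⟨ solve 3 (λ a j t → a :+ (j :+ con 1) :+ t := a :+ (con 1 :+ (t :+ j))) refl (A t) j t ⟩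
      A t + suc (t + j)   ≡⟨ cong (λ x → A t + suc x) j′+N≡ ⟨
      A t + suc (j′ + N)  ≡⟨ solve 3 (λ a j n → a :+ (con 1 :+ (j :+ n)) := a :+ j :+ (con 1 :+ n)) refl (A t) j′ N ⟩
      A t + j′ + suc N    ≤⟨ +-monoˡ-≤ (suc N) (min j′ (≤-trans j′≤t t≤M)) ⟩
      A j′ + t + suc N    ≡⟨ solve 3 (λ a t n → a :+ t :+ n := a :+ n :+ t) refl (A j′) t (suc N) ⟩
      A j′ + suc N + t    ≡⟨ cong (_+ t) (periodic j′) ⟨
      A (j′ + N) + t      ≡⟨ cong (λ x → A x + t) j′+N≡ ⟩
      A (t + j) + t       ∎)
      where
      j′ = t + j ∸ N
      j′+N≡ : j′ + N ≡ t + j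
      j′+N≡ = m∸n+n≡m (≮⇒≥ t+j≮N)
      j′≤t : j′ ≤ t
      j′≤t = ≤-trans (∸-monoˡ-≤ N (+-monoʳ-≤ t j≤N)) (≤-reflexive (m+n∸n≡m t N))

  -- With d = t - s, the sequence gains at least d + 1 from s to t and at least N - d + 1 from t to
  -- s + N: together N + 2, more than the N + 1 of a period.
  good-not-< : ∀ {s t} → s < t → t < N → Good s → ¬ Good t
  good-not-< {s} {t} s<t t<N gs gt = <-irrefl refl (begin-strict
    A s + suc N                          ≡⟨ cong (λ x → A s + suc x) (m+[n∸m]≡n d≤N) ⟨
    A s + suc (d + (N ∸ d))              <⟨ n<1+n _ ⟩
    suc (A s + suc (d + (N ∸ d)))        ≡⟨ solve 3 (λ a d e → con 1 :+ (a :+ (con 1 :+ (d :+ e))) := a :+ (d :+ con 1) :+ (e :+ con 1)) refl (A s) d (N ∸ d) ⟩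
    A s + (d + 1) + (N ∸ d + 1)          ≤⟨ +-monoˡ-≤ (N ∸ d + 1) (gs d (m<n⇒0<n∸m s<t) d≤N) ⟩
    A (s + d) + (N ∸ d + 1)              ≡⟨ cong (λ x → A x + (N ∸ d + 1)) s+d≡t ⟩
    A t + (N ∸ d + 1)                    ≤⟨ gt (N ∸ d) (m<n⇒0<n∸m d<N) (m∸n≤m N d) ⟩
    A (t + (N ∸ d))                      ≡⟨ cong A t+[N∸d]≡s+N ⟩
    A (s + N)                            ≡⟨ periodic s ⟩
    A s + suc N                          ∎)
    where
    open ≤-Reasoning
    open +-*-Solver
    d = t ∸ s
    d<N : d < N
    d<N = ≤-<-trans (m∸n≤m t s) t<N
    d≤N : d ≤ N
    d≤N = <⇒≤ d<N
    s+d≡t : s + d ≡ t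
    s+d≡t = m+[n∸m]≡n (<⇒≤ s<t)
    t+[N∸d]≡s+N : t + (N ∸ d) ≡ s + N
    t+[N∸d]≡s+N = trans (cong (_+ (N ∸ d)) (sym s+d≡t))
      (trans (+-assoc s d (N ∸ d)) (cong (s +_) (m+[n∸m]≡n d≤N)))

  good-unique : ∀ {s t} → s < N → t < N → Good s → Good t → s ≡ t
  good-unique {s} {t} s<N t<N gs gt with <-cmp s t
  ... | tri< s<t _ _ = contradiction gt (good-not-< s<t t<N gs)
  ... | tri≈ _ s≡t _ = s≡t
  ... | tri> _ _ t<s = contradiction gs (good-not-< t<s s<N gt)

-- Conjugation by rotations and the prime representative

lookup-∷ʳ-inject₁ : {A : Set} {n : ℕ} (v : Vec A n) (x : A) (i : Fin n) →
                    lookup (v Vec.∷ʳ x) (inject₁ i) ≡ lookup v i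
lookup-∷ʳ-inject₁ (y ∷ v) x zero    = refl
lookup-∷ʳ-inject₁ (y ∷ v) x (suc i) = lookup-∷ʳ-inject₁ v x i

values-injective : ∀ {M n} {u v : Vec (Fin M) n} → values u ≡ values v → u ≡ v
values-injective {u = u} {v} eq = lookup-extensional λ i → Fin.toℕ-injective (suc-injective
  (trans (sym (Vec.lookup-map i _ u)) (trans (cong (λ w → lookup w i) eq) (Vec.lookup-map i _ v))))

values-surjective : ∀ {M n} (v : Vec ℕ n) → VecAll.All (1 ≤_) v → VecAll.All (_≤ M) v →
                    ∃[ u ] values {M} u ≡ v
values-surjective []          _                        _ = [] , refl
values-surjective (suc x ∷ v) (_ VecAll.∷ pos) (x<M VecAll.∷ bd) =
  let (u , eq) = values-surjective v pos bd in
  fromℕ< x<M ∷ u , cong₂ _∷_ (cong suc (Fin.toℕ-fromℕ< x<M)) eq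

∑-lookup : {A : Set} {n : ℕ} (v : Vec A n) (f : A → ℕ) →
           ∑ (toList v) f ≡ ∑ (allFin n) (f ∘ lookup v)
∑-lookup {n = n} v f = begin
  ∑ (toList v) f                   ≡⟨ cong (λ xs → ∑ xs f) (tabulate-lookup v) ⟨
  ∑ (List.tabulate (lookup v)) f   ≡⟨ cong (λ xs → ∑ xs f) (List.map-tabulate id (lookup v)) ⟨
  ∑ (map (lookup v) (allFin n)) f  ≡⟨ ∑-map (allFin n) (lookup v) f ⟩
  ∑ (allFin n) (f ∘ lookup v)      ∎
  where open ≡-Reasoning

𝟙-<?-suc : ∀ x j → 𝟙 (x <? suc j) ≡ 𝟙 (x <? j) + 𝟙 (x ≟ j)
𝟙-<?-suc x j = 𝟙-⊎ (x <? j) (x ≟ j) (x <? suc j) m≤n⇒m≤1+n (λ { refl → ≤-refl })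
  (m≤n⇒m<n∨m≡n ∘ s≤s⁻¹) (λ (x<j , x≡j) → <-irrefl x≡j x<j)

module _ {N : ℕ} .{{_ : NonZero N}} where

  private
    origin : Fin N
    origin = 0 mod N

  -- Subtraction of t modulo N, written as an addition.
  down : Fin N → Fin N → Fin N
  down t = shift (toℕ t * pred N)

  down-injective : ∀ t {i j} → down t i ≡ down t j → i ≡ j
  down-injective t = shift-injective (toℕ t * pred N)

  up-down : ∀ t i → shift (toℕ t) (down t i) ≡ i
  up-down t = shift-inverseʳ (toℕ t)

  down-up : ∀ t i → down t (shift (toℕ t) i) ≡ i
  down-up t = shift-inverseˡ (toℕ t)

  conjugate : Fin N → Vec (Fin N) N → Vec (Fin N) N
  conjugate t g = tabulate (λ i → down t (lookup g (shift (toℕ t) i)))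

  lookup-conjugate : ∀ t g i → lookup (conjugate t g) (down t i) ≡ down t (lookup g i)
  lookup-conjugate t g i = trans (Vec.lookup∘tabulate _ (down t i)) (cong (down t ∘ lookup g) (up-down t i))

  -- A function on {1, …, N}, extended by sending N + 1 to 1, conjugated by the rotation
  -- of {1, …, N} (N + 1 being fixed) that lowers residues by t.
  rotated : Fin N → Vec (Fin N) N → Vec (Fin N) (suc N)
  rotated t g = conjugate t g Vec.∷ʳ down t origin

  -- The last entry is -t and so reveals t; for known t the conjugation can be undone.
  rotated-injective : ∀ {s t g h} → rotated s g ≡ rotated t h → g ≡ h
  rotated-injective {s} {t} {g} {h} eq with Vec.∷ʳ-injective (conjugate s g) (conjugate t h) eq
  ... | eq₁ , eq₂ = lookup-extensional λ i → down-injective s (begin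
    down s (lookup g i)               ≡⟨ lookup-conjugate s g i ⟨
    lookup (conjugate s g) (down s i) ≡⟨ cong (λ v → lookup v (down s i)) eq₁ ⟩
    lookup (conjugate t h) (down s i) ≡⟨ cong (λ r → lookup (conjugate t h) (down r i)) s≡t ⟩
    lookup (conjugate t h) (down t i) ≡⟨ lookup-conjugate t h i ⟩
    down t (lookup h i)               ≡⟨ cong (λ r → down r (lookup h i)) s≡t ⟨
    down s (lookup h i)               ∎)
    where
    open ≡-Reasoning
    x = down s origin
    s≡t : s ≡ t
    -- x is both -s and -t, so adding it to s or to t gives `origin`.
    s≡t = shift-injective (toℕ x) (begin
      shift (toℕ x) s                     ≡⟨ shift-swap s x ⟨
      shift (toℕ s) (down s origin)       ≡⟨ up-down s origin ⟩
      origin                              ≡⟨ up-down t origin ⟨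
      shift (toℕ t) (down t origin)       ≡⟨ cong (shift (toℕ t)) eq₂ ⟨
      shift (toℕ t) x                     ≡⟨ shift-swap t x ⟩
      shift (toℕ x) t                     ∎)

  rotated-surjective : ∀ u → ∃[ t ] ∃[ g ] rotated t g ≡ u
  rotated-surjective u with Vec.initLast u
  ... | h , w , refl = t , g , cong₂ Vec._∷ʳ_
    (lookup-extensional λ i → begin
      lookup (conjugate t g) i
        ≡⟨ Vec.lookup∘tabulate _ i ⟩
      down t (lookup g (shift (toℕ t) i))
        ≡⟨ cong (down t) (Vec.lookup∘tabulate _ (shift (toℕ t) i)) ⟩
      down t (shift (toℕ t) (lookup h (down t (shift (toℕ t) i))))
        ≡⟨ down-up t _ ⟩
      lookup h (down t (shift (toℕ t) i))
        ≡⟨ cong (lookup h) (down-up t i) ⟩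
      lookup h i ∎)
    (trans (cong (down t) (trans (sym (up-down w origin)) (shift-swap w t))) (down-up t w))
    where
    open ≡-Reasoning
    -- The last entry of `rotated t g` is -t, which forces t to be -w; then `g` is `h` conjugated
    -- back.
    t : Fin N
    t = down w origin
    g : Vec (Fin N) N
    g = tabulate (λ i → shift (toℕ t) (lookup h (down t i)))

  module _ (g : Vec (Fin N) N) where

    -- Multiplicity of the residue of u among the N + 1 values, the last summand being the value at
    -- N + 1. Indexing by all of ℕ gives the periodic sequence that the cycle lemma expects.
    content : ℕ → ℕ
    content u = ∑ (allFin N) (λ i → 𝟙 (lookup g i Fin.≟ u mod N)) + 𝟙 (origin Fin.≟ u mod N)

    prefix : ℕ → ℕ
    prefix zero    = 0
    prefix (suc j) = prefix j + content j

    below : Fin N → ℕ → ℕ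
    below t j = ∑ (allFin N) (λ i → 𝟙 (toℕ (down t (lookup g i)) <? j)) + 𝟙 (toℕ (down t origin) <? j)

    -- The count ignores the order of the entries: reindexing by the rotation leaves only the
    -- translation of the values.
    count-rotated : ∀ t j → Vec.count (_≤? j) (values (rotated t g)) ≡ below t j
    count-rotated t j = begin
      Vec.count (_≤? j) (values (rotated t g))
        ≡⟨ count≡∑ (_≤? j) (values (rotated t g)) ⟩
      ∑ (toList (values (rotated t g))) (λ x → 𝟙 (x ≤? j))
        ≡⟨ cong (λ xs → ∑ xs (λ x → 𝟙 (x ≤? j))) (Vec.toList-map _ (rotated t g)) ⟩
      ∑ (map (suc ∘ toℕ) (toList (rotated t g))) (λ x → 𝟙 (x ≤? j))
        ≡⟨ ∑-map (toList (rotated t g)) _ _ ⟩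
      ∑ (toList (rotated t g)) (λ v → 𝟙 (toℕ v <? j))
        ≡⟨ cong (λ xs → ∑ xs (λ v → 𝟙 (toℕ v <? j))) (Vec.toList-∷ʳ (down t origin) (conjugate t g)) ⟩
      ∑ (toList (conjugate t g) ++ down t origin ∷ []) (λ v → 𝟙 (toℕ v <? j))
        ≡⟨ ∑-++ (toList (conjugate t g)) _ _ ⟩
      ∑ (toList (conjugate t g)) (λ v → 𝟙 (toℕ v <? j)) + (𝟙 (toℕ (down t origin) <? j) + 0)
        ≡⟨ cong₂ _+_ reindexed (+-identityʳ _) ⟩
      below t j ∎
      where
      open ≡-Reasoning
      reindexed : ∑ (toList (conjugate t g)) (λ v → 𝟙 (toℕ v <? j))
                  ≡ ∑ (allFin N) (λ i → 𝟙 (toℕ (down t (lookup g i)) <? j))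
      reindexed = begin
        ∑ (toList (conjugate t g)) (λ v → 𝟙 (toℕ v <? j))
          ≡⟨ ∑-lookup (conjugate t g) _ ⟩
        ∑ (allFin N) (λ i → 𝟙 (toℕ (lookup (conjugate t g) i) <? j))
          ≡⟨ ∑-cong (allFin N) (λ i → cong (λ v → 𝟙 (toℕ v <? j)) (Vec.lookup∘tabulate _ i)) ⟩
        ∑ (allFin N) (λ i → 𝟙 (toℕ (down t (lookup g (shift (toℕ t) i))) <? j))
          ≡⟨ ∑-reindex (allFin-enumerates N) (shift (toℕ t)) (down t) (up-down t) (down-up t)
               (λ i → 𝟙 (toℕ (down t (lookup g i)) <? j)) ⟩
        ∑ (allFin N) (λ i → 𝟙 (toℕ (down t (lookup g i)) <? j)) ∎

    𝟙-down≟ : ∀ t v {j} → j < N → 𝟙 (toℕ (down t v) ≟ j) ≡ 𝟙 (v Fin.≟ (toℕ t + j) mod N)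
    𝟙-down≟ t v {j} j<N = 𝟙-cong (toℕ (down t v) ≟ j) (v Fin.≟ (toℕ t + j) mod N)
      (λ eq → trans (sym (up-down t v)) (trans (cong (shift (toℕ t)) (Fin.toℕ-injective (trans eq (sym toℕ-j)))) shift-j))
      (λ eq → trans (cong toℕ (trans (cong (down t) (trans eq (sym shift-j))) (down-up t j′))) toℕ-j)
      where
      j′ : Fin N
      j′ = fromℕ< j<N
      toℕ-j : toℕ j′ ≡ j
      toℕ-j = Fin.toℕ-fromℕ< j<N
      shift-j : shift (toℕ t) j′ ≡ (toℕ t + j) mod N
      shift-j = cong (_mod N) (trans (cong (_+ toℕ t) toℕ-j) (+-comm j (toℕ t)))

    below-suc : ∀ t {j} → j < N → below t (suc j) ≡ below t j + content (toℕ t + j)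
    below-suc t {j} j<N = begin
      ∑ (allFin N) (λ i → 𝟙 (x i <? suc j)) + 𝟙 (toℕ (down t origin) <? suc j)
        ≡⟨ cong₂ _+_ (∑-cong (allFin N) (λ i → step (lookup g i))) (step origin) ⟩
      ∑ (allFin N) (λ i → 𝟙 (x i <? j) + 𝟙 (lookup g i Fin.≟ (toℕ t + j) mod N))
        + (𝟙 (toℕ (down t origin) <? j) + 𝟙 (origin Fin.≟ (toℕ t + j) mod N))
        ≡⟨ cong (_+ (𝟙 (toℕ (down t origin) <? j) + 𝟙 (origin Fin.≟ (toℕ t + j) mod N))) (∑-+ (allFin N) _ _) ⟩
      ∑ (allFin N) (λ i → 𝟙 (x i <? j)) + ∑ (allFin N) (λ i → 𝟙 (lookup g i Fin.≟ (toℕ t + j) mod N))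
        + (𝟙 (toℕ (down t origin) <? j) + 𝟙 (origin Fin.≟ (toℕ t + j) mod N))
        ≡⟨ interchange +-commutativeSemigroup (∑ (allFin N) (λ i → 𝟙 (x i <? j))) _ _ _ ⟩
      below t j + content (toℕ t + j) ∎
      where
      open ≡-Reasoning
      x : Fin N → ℕ
      x i = toℕ (down t (lookup g i))
      step : ∀ v → 𝟙 (toℕ (down t v) <? suc j)
                   ≡ 𝟙 (toℕ (down t v) <? j) + 𝟙 (v Fin.≟ (toℕ t + j) mod N)
      step v = trans (𝟙-<?-suc (toℕ (down t v)) j) (cong (𝟙 (toℕ (down t v) <? j) +_) (𝟙-down≟ t v j<N))

    below-0 : ∀ t → below t 0 ≡ 0
    below-0 t = cong (_+ 0) (trans (∑-const (allFin N) 0) (*-zeroʳ (length (allFin N))))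

    below-N : ∀ t → below t N ≡ suc N
    below-N t = begin
      below t N
        ≡⟨ cong₂ _+_ (∑-cong (allFin N) (λ i → 𝟙-yes (_ <? N) (Fin.toℕ<n (down t (lookup g i)))))
                     (𝟙-yes (_ <? N) (Fin.toℕ<n (down t origin))) ⟩
      ∑ (allFin N) (λ _ → 1) + 1
        ≡⟨ cong (_+ 1) (trans (∑-const (allFin N) 1) (trans (*-identityʳ _) (length-allFin N))) ⟩
      N + 1
        ≡⟨ +-comm N 1 ⟩
      suc N ∎
      where open ≡-Reasoning

    -- `down t` carries the residues t, ..., t + j - 1 to 0, ..., j - 1, so counting small values
    -- after the rotation is counting in a window of the original sequence.
    prefix-below : ∀ t j → j ≤ N → prefix (toℕ t) + below t j ≡ prefix (toℕ t + j)
    prefix-below t zero    _   = trans (cong (prefix (toℕ t) +_) (below-0 t))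
      (trans (+-identityʳ _) (cong prefix (sym (+-identityʳ (toℕ t)))))
    prefix-below t (suc j) j<N = begin
      prefix (toℕ t) + below t (suc j)                        ≡⟨ cong (prefix (toℕ t) +_) (below-suc t j<N) ⟩
      prefix (toℕ t) + (below t j + content (toℕ t + j))      ≡⟨ +-assoc (prefix (toℕ t)) _ _ ⟨
      prefix (toℕ t) + below t j + content (toℕ t + j)        ≡⟨ cong (_+ content (toℕ t + j)) (prefix-below t j (<⇒≤ j<N)) ⟩
      prefix (suc (toℕ t + j))                                ≡⟨ cong prefix (+-suc (toℕ t) j) ⟨
      prefix (toℕ t + suc j)                                  ∎
      where open ≡-Reasoning

    -- A window of N consecutive residues captures all N + 1 values. The base case reads this off
    -- `prefix-below` at `origin`; the step uses that `content` depends only on the residue.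
    prefix-periodic : ∀ j → prefix (j + N) ≡ prefix j + suc N
    prefix-periodic zero    = begin
      prefix N                                ≡⟨ cong (λ x → prefix (x + N)) toℕ-origin ⟨
      prefix (toℕ origin + N)                 ≡⟨ prefix-below origin N ≤-refl ⟨
      prefix (toℕ origin) + below origin N    ≡⟨ cong₂ _+_ (cong prefix toℕ-origin) (below-N origin) ⟩
      suc N                                   ∎
      where
      open ≡-Reasoning
      toℕ-origin : toℕ origin ≡ 0
      toℕ-origin = trans (Fin.toℕ-fromℕ< (m%n<n 0 N)) (m<n⇒m%n≡m (>-nonZero⁻¹ N))
    prefix-periodic (suc j) = begin
      prefix (j + N) + content (j + N)   ≡⟨ cong₂ _+_ (prefix-periodic j) (content-periodic j) ⟩
      prefix j + suc N + content j       ≡⟨ +-assoc (prefix j) (suc N) _ ⟩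
      prefix j + (suc N + content j)     ≡⟨ cong (prefix j +_) (+-comm (suc N) (content j)) ⟩
      prefix j + (content j + suc N)     ≡⟨ +-assoc (prefix j) _ _ ⟨
      prefix (suc j) + suc N             ∎
      where
      open ≡-Reasoning
      content-periodic : ∀ u → content (u + N) ≡ content u
      content-periodic u = cong (λ r → ∑ (allFin N) (λ i → 𝟙 (lookup g i Fin.≟ r)) + 𝟙 (origin Fin.≟ r))
        (Fin.toℕ-injective (trans (Fin.toℕ-fromℕ< (m%n<n (u + N) N))
          (trans ([m+n]%n≡m%n u N) (sym (Fin.toℕ-fromℕ< (m%n<n u N))))))

    open CycleLemma prefix N prefix-periodic

    good⇒prime : ∀ t → Good (toℕ t) → IsPrimeParkingFunction (values (rotated t g))
    good⇒prime t good = isPrimeParkingFunction⁺ (values (rotated t g))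
      (VecAll.map⁺ (VecAll.universal (λ _ → s≤s z≤n) (rotated t g)))
      (λ j 1≤j j≤N → +-cancelˡ-≤ (prefix (toℕ t)) _ _ (≤-trans (good j 1≤j j≤N) (≤-reflexive (begin
        prefix (toℕ t + j)            ≡⟨ prefix-below t j j≤N ⟨
        prefix (toℕ t) + below t j    ≡⟨ cong (prefix (toℕ t) +_) (count-rotated t j) ⟨
        prefix (toℕ t) + Vec.count (_≤? j) (values (rotated t g)) ∎))))
      where open ≡-Reasoning

    prime⇒good : ∀ t → IsPrimeParkingFunction (values (rotated t g)) → Good (toℕ t)
    prime⇒good t p j 1≤j j≤N = ≤-trans
      (+-monoʳ-≤ (prefix (toℕ t)) (≤-trans (IsPrimeParkingFunction.prime p j 1≤j j≤N) (≤-reflexive (count-rotated t j))))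
      (≤-reflexive (prefix-below t j j≤N))

    prime-rotation : Fin N
    prime-rotation = fromℕ< (proj₁ (proj₂ good-exists))

    prime-rotation-prime : IsPrimeParkingFunction (values (rotated prime-rotation g))
    prime-rotation-prime = good⇒prime prime-rotation
      (subst Good {proj₁ good-exists} (sym (Fin.toℕ-fromℕ< (proj₁ (proj₂ good-exists)))) (proj₂ (proj₂ good-exists)))

    prime-rotation-unique : ∀ t → IsPrimeParkingFunction (values (rotated t g)) → t ≡ prime-rotation
    prime-rotation-unique t p = Fin.toℕ-injective (good-unique (Fin.toℕ<n t) (Fin.toℕ<n prime-rotation)
      (prime⇒good t p) (prime⇒good prime-rotation prime-rotation-prime))

  toPrime : Vec (Fin N) N → Vec ℕ (suc N)
  toPrime g = values (rotated (prime-rotation g) g)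

  toPrime-prime : ∀ g → IsPrimeParkingFunction (toPrime g)
  toPrime-prime = prime-rotation-prime

  toPrime-injective : ∀ {g h} → toPrime g ≡ toPrime h → g ≡ h
  toPrime-injective eq = rotated-injective (values-injective eq)

  toPrime-surjective : ∀ π → IsPrimeParkingFunction π → ∃[ g ] toPrime g ≡ π
  toPrime-surjective π p
    with values-surjective π (IsParkingFunction.positive (IsPrimeParkingFunction.isParkingFunction p))
           -- Primality at j = N says that all N + 1 entries are at most N, which makes `π` come
           -- from a vector over `Fin N`.
           (count-full (_≤? N) π (≤-trans (≤-reflexive (+-comm 1 N))
             (IsPrimeParkingFunction.prime p N (>-nonZero⁻¹ N) ≤-refl)))
  ... | u , refl with rotated-surjective u
  ...   | t , g , refl = g , cong (λ s → values (rotated s g)) (sym (prime-rotation-unique g t p))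

  -- Invariance of the number of cycles

  module _ {m : ℕ} .{{_ : NonZero m}} (t : Fin N) (g : Vec (Fin N) N) where

    private
      π : Vec ℕ (suc N)
      π = values (rotated t g)

      φ : Fin N → Fin (suc N)
      φ i = inject₁ (down t i)

      φ-injective : ∀ {i j} → φ i ≡ φ j → i ≡ j
      φ-injective = down-injective t ∘ Fin.inject₁-injective

      -- `φ` intertwines `g` with `π`, so cycles are carried forward along `φ` and, inside its
      -- image, back.
      lookup-π : ∀ i → lookup π (φ i) ≡ suc (toℕ (φ (lookup g i)))
      lookup-π i = begin
        lookup π (φ i)                                       ≡⟨ Vec.lookup-map (φ i) _ (rotated t g) ⟩
        suc (toℕ (lookup (rotated t g) (φ i)))               ≡⟨ cong (suc ∘ toℕ) (lookup-∷ʳ-inject₁ (conjugate t g) _ (down t i)) ⟩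
        suc (toℕ (lookup (conjugate t g) (down t i)))        ≡⟨ cong (suc ∘ toℕ) (lookup-conjugate t g i) ⟩
        suc (toℕ (down t (lookup g i)))                      ≡⟨ cong suc (Fin.toℕ-inject₁ (down t (lookup g i))) ⟨
        suc (toℕ (φ (lookup g i)))                           ∎
        where open ≡-Reasoning

      to : ∀ (c : Vec (Fin N) m) → IsCycle (values g) c → IsCycle π (Vec.map φ c)
      to c p = record
        { distinct = VecUnique.map⁺ φ-injective (IsCycle.distinct p)
        ; cyclic   = λ j → begin
            lookup π (lookup (Vec.map φ c) j)                ≡⟨ cong (lookup π) (Vec.lookup-map j φ c) ⟩
            lookup π (φ (lookup c j))                        ≡⟨ lookup-π (lookup c j) ⟩
            suc (toℕ (φ (lookup g (lookup c j))))            ≡⟨ cong (suc ∘ toℕ ∘ φ) (next j) ⟩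
            suc (toℕ (φ (lookup c (shift 1 j))))             ≡⟨ cong (suc ∘ toℕ) (Vec.lookup-map (shift 1 j) φ c) ⟨
            suc (toℕ (lookup (Vec.map φ c) (shift 1 j)))     ∎
        }
        where
        open ≡-Reasoning
        next : ∀ j → lookup g (lookup c j) ≡ lookup c (shift 1 j)
        next j = Fin.toℕ-injective (suc-injective
          (trans (sym (Vec.lookup-map (lookup c j) _ g)) (IsCycle.cyclic p j)))

      from : ∀ (d : Vec (Fin (suc N)) m) → IsCycle π d → ∃[ c ] (IsCycle (values g) c × Vec.map φ c ≡ d)
      from d p = c , record
        { distinct = unique-from-injective c λ {i} {j} eq → VecUnique.lookup-injective (IsCycle.distinct p) i j
            (trans (sym (φ-c i)) (trans (cong φ eq) (φ-c j)))
        ; cyclic   = λ j → trans (Vec.lookup-map (lookup c j) _ g) (cong (suc ∘ toℕ) (φ-injective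
            (Fin.toℕ-injective (suc-injective (begin
              suc (toℕ (φ (lookup g (lookup c j))))  ≡⟨ lookup-π (lookup c j) ⟨
              lookup π (φ (lookup c j))              ≡⟨ cong (lookup π) (φ-c j) ⟩
              lookup π (lookup d j)                  ≡⟨ IsCycle.cyclic p j ⟩
              suc (toℕ (lookup d (shift 1 j)))       ≡⟨ cong (suc ∘ toℕ) (φ-c (shift 1 j)) ⟨
              suc (toℕ (φ (lookup c (shift 1 j))))   ∎)))))
        } , lookup-extensional (λ j → trans (Vec.lookup-map j φ c) (φ-c j))
        where
        open ≡-Reasoning
        entry<N : ∀ j → toℕ (lookup d (shift 1 j)) < N
        entry<N j = subst (_≤ N) (trans (sym (Vec.lookup-map (lookup d j) _ (rotated t g))) (IsCycle.cyclic p j))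
          (Fin.toℕ<n (lookup (rotated t g) (lookup d j)))
        -- Every index of a cycle is the image of its predecessor, found at position j - 1, and
        -- images avoid the top index.
        d<N : ∀ j → toℕ (lookup d j) < N
        d<N j = subst (λ i → toℕ (lookup d i) < N) (shift-inverseʳ 1 j) (entry<N (shift (1 * pred m) j))
        c : Vec (Fin N) m
        c = tabulate (λ j → shift (toℕ t) (fromℕ< (d<N j)))
        φ-c : ∀ j → φ (lookup c j) ≡ lookup d j
        φ-c j = trans (cong φ (Vec.lookup∘tabulate _ j)) (trans (cong inject₁ (down-up t (fromℕ< (d<N j))))
          (Fin.toℕ-injective (trans (Fin.toℕ-inject₁ _) (Fin.toℕ-fromℕ< (d<N j)))))

    #cycles-rotated : #cycles {m} (values g) ≡ #cycles {m} (values (rotated t g))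
    #cycles-rotated = count-bijection (isCycle? (values g)) (isCycle? π) blocks-enumerate blocks-enumerate
      (Vec.map φ) (λ {x} {y} eq → lookup-extensional λ i → φ-injective
        (trans (sym (Vec.lookup-map i φ x)) (trans (cong (λ v → lookup v i) eq) (Vec.lookup-map i φ y))))
      to from

-- The enumeration of prime parking functions with k cycles

open import Data.Integer using (+_)
open import Data.Rational using (_/_)

theorem3p3 : (n m k : ℕ) .{{_ : NonZero m}} → 2 ≤ n → k * m ≤ n ∸ 1 →
    ∃[ N ] HasCardinality (setoid (Vec ℕ n)) (λ π → IsPrimeParkingFunction π × HasExactlyCycles π k m) N
    × (+ N) / 1 ≡ cycleSum n m k
theorem3p3 (suc (suc N′)) m k (s≤s (s≤s _)) _ = ∑ functions (𝟙 ∘ hasK?) , record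
  { elements = map (toPrime {N}) (filter hasK? functions)
  ; sound    = All.map⁺ (All.map (toPrime-sound _) (All.all-filter hasK? functions))
  ; complete = λ π (p , h) → let (g , eq) = toPrime-surjective {N} π p in
      subst (_∈ _) eq (∈-map⁺ (toPrime {N}) (∈-filter⁺ hasK? (Enumerates.complete functions-enumerate g)
        -- The two numbers of cycles are compared through the pointed counts, from which the factor
        -- m cancels.
        (*-cancelʳ-≡ _ _ m (trans (sym (#cycles≡cycle-number {m} N g)) (trans (#cycles-toPrime g)
          (#cycles-exact (toPrime {N} g) (subst (λ π → HasExactlyCycles π k m) (sym eq) h)))))))
  ; distinct = Unique.map⁺ (toPrime-injective {N}) (Unique.filter⁺ hasK? (Enumerates.unique functions-enumerate))
  ; size     = trans (List.length-map (toPrime {N}) (filter hasK? functions)) (length-filter hasK? functions)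
  } , cycleSum-counts {m} N k
  where
  -- N is n - 1, nonzero because n is at least 2, as residues modulo N require.
  N : ℕ
  N = suc N′
  functions : List (Vec (Fin N) N)
  functions = vecs (allFin N) N
  functions-enumerate : Enumerates functions
  functions-enumerate = vecs-enumerates (allFin-enumerates N) N
  hasK? : Decidable (λ g → cycle-number {m} N g ≡ k)
  hasK? g = cycle-number {m} N g ≟ k
  #cycles-toPrime : ∀ g → #cycles {m} (values g) ≡ #cycles {m} (toPrime {N} g)
  #cycles-toPrime g = #cycles-rotated (prime-rotation {N} g) g
  toPrime-sound : ∀ g → cycle-number {m} N g ≡ k →
                  IsPrimeParkingFunction (toPrime {N} g) × HasExactlyCycles (toPrime {N} g) k m
  toPrime-sound g c≡k = toPrime-prime {N} g , #cycles-reflects (toPrime {N} g)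
    (trans (sym (#cycles-toPrime g)) (trans (#cycles≡cycle-number {m} N g) (cong (_* m) c≡k)))
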